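{- Let $C_{37}$ be the simplicial complex obtained from $37$ disjoint copies of $Q^*$ by identifying them along the subcomplex $A^*$. Then $C_{37}$ is balanced, Cohen-Macaulay (over any field), and not partitionable.
   Context: $Q^*$ is the $3$-dimensional simplicial complex on vertex set $\{0,1,\dots,13\}$ whose faces are all subsets of the following $20$ facets: $\{2,5,6,12\}$, $\{1,5,8,11\}$, $\{0,1,2,5\}$, $\{1,4,8,9\}$, $\{1,2,3,10\}$, $\{4,5,8,13\}$, $\{0,1,2,3\}$, $\{1,4,9,10\}$, $\{1,2,9,10\}$, $\{1,2,5,6\}$, $\{0,2,5,12\}$, $\{4,5,7,13\}$, $\{1,4,5,8\}$, $\{1,2,6,9\}$, $\{1,3,4,7\}$, $\{1,3,4,10\}$, $\{1,5,6,11\}$, $\{1,4,5,7\}$, $\{1,6,9,11\}$, $\{1,8,9,11\}$. $A^*$ is the induced subcomplex of $Q^*$ on vertex set $\{0,2,3,4,6,7,8,10,12,13\}$; its facets are $\{0,2,3\}$, $\{4,7,13\}$, $\{3,4,10\}$, $\{0,2,12\}$, $\{3,4,7\}$, $\{2,3,10\}$, $\{2,6,12\}$, $\{4,8,13\}$. Identifying $N$ copies of $Q^*$ along $A^*$ means taking copies $Q^*_1,\dots,Q^*_N$ with pairwise disjoint vertex sets except that the vertices of $A^*$ are shared (the same in all copies). A $(d-1)$-dimensional complex is balanced if its graph is properly $d$-colorable. A pure simplicial complex with facets $F_1,\dots,F_n$ is partitionable if its faces are the disjoint union of Boolean intervals $[R_i,F_i]=\{G: R_i\subseteq G\subseteq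 F_i\}$. A $(d-1)$-dimensional complex $\Delta$ is Cohen-Macaulay over a field $\mathbb{F}$ if for every face $F$ (including $\emptyset$), $\widetilde{H}_i(\mathrm{lk}_\Delta(F);\mathbb{F})=0$ for all $i\neq d-1-\#F$, where $\mathrm{lk}_\Delta(F)=\{G\in\Delta: G\cap F=\emptyset, G\cup F\in\Delta\}$. -}

module Defs where

open import Algebra.Apartness.Bundles
  using (HeytingField; module HeytingCommutativeRing)
open import Algebra.Bundles using (CommutativeRing)
open import Data.Bool.Base using (true; false; if_then_else_)
open import Data.Fin using (#_)
open import Data.Fin.Base using (Fin; zero; suc; combine; join)
open import Data.Fin.Properties using (any?) renaming (_≟_ to _≟ᶠ_)
open import Data.Fin.Subset
open import Data.Fin.Subset.Properties
open import Data.Integer.Base as ℤ using (ℤ; +_; 1ℤ)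
open import Data.List.Base using (List; []; _∷_; map)
open import Data.List.Relation.Unary.Any as Any using (Any)
open import Data.Nat.Base using (ℕ; zero; suc; _+_; _*_; _≤_)
open import Data.Product using (∃; ∃₂; ∃!; _×_; _,_)
open import Data.Sum.Base as Sum using (_⊎_; inj₁; inj₂)
open import Data.Vec.Base using ([]; _∷_)
open import Function.Base using (_∘_)
open import Level using (0ℓ; _⊔_)
open import Relation.Binary.PropositionalEquality using (_≡_; _≢_)
open import Relation.Nullary.Decidable using (does; ¬?; _×-dec_)
open import Relation.Nullary.Negation using (¬_)
open import Relation.Unary using (Pred; Decidable)

private
  variable
    n : ℕ

-- An element v : Fin n need not be a vertex, i.e. ⁅ v ⁆ need not be a
-- face.  A nonempty complex has ⊥ (the empty set) as a face.
record SimplicialComplex (n : ℕ) : Set₁ where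
  field
    Face        : Pred (Subset n) 0ℓ
    face?       : Decidable Face
    down-closed : ∀ {F G} → G ⊆ F → Face F → Face G

open SimplicialComplex public

generatedBy : List (Subset n) → SimplicialComplex n
generatedBy Fs .Face G  = Any (G ⊆_) Fs
generatedBy Fs .face? G = Any.any? (G ⊆?_) Fs
generatedBy Fs .down-closed {F} {G} G⊆F =
  Any.map {P = F ⊆_} {Q = G ⊆_} (λ F⊆H x∈G → F⊆H (G⊆F x∈G))

link : SimplicialComplex n → Subset n → SimplicialComplex n
link Δ F .Face G  = Empty (G ∩ F) × Face Δ (G ∪ F)
link Δ F .face? G = ¬? (nonempty? (G ∩ F)) ×-dec face? Δ (G ∪ F)
link Δ F .down-closed {H} {G} G⊆H (H∩F=∅ , H∪F∈Δ) =
    (λ (x , x∈G∩F) → let (x∈G , x∈F) = x∈p∩q⁻ G F x∈G∩F in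
                     H∩F=∅ (x , x∈p∩q⁺ (G⊆H x∈G , x∈F)))
  , down-closed Δ
      (λ x∈G∪F → x∈p∪q⁺ (Sum.map₁ G⊆H (x∈p∪q⁻ G F x∈G∪F)))
      H∪F∈Δ

dim : Subset n → ℤ
dim F = + ∣ F ∣ ℤ.- 1ℤ

-- Δ has a face and is of dimension d - 1.
HasRank : SimplicialComplex n → ℕ → Set
HasRank Δ d =
  (∀ {F} → Face Δ F → ∣ F ∣ ≤ d) × ∃ λ F → Face Δ F × ∣ F ∣ ≡ d

IsFacet : SimplicialComplex n → Subset n → Set
IsFacet Δ F = Face Δ F × (∀ {G} → Face Δ G → F ⊆ G → F ≡ G)

Colorable : SimplicialComplex n → ℕ → Set
Colorable {n} Δ d = ∃ λ (κ : Fin n → Fin d) →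
  ∀ {u v} → u ≢ v → Face Δ (⁅ u ⁆ ∪ ⁅ v ⁆) → κ u ≢ κ v

Balanced : SimplicialComplex n → Set
Balanced Δ = ∃ λ d → HasRank Δ d × Colorable Δ d

-- The values of R at subsets other than facets are irrelevant.  Every
-- [ R F , F ] consists of faces, so the unique existence below says that
-- these intervals are disjoint and that their union is the set of faces.
Partitionable : SimplicialComplex n → Set
Partitionable {n} Δ = ∃ λ (R : Subset n → Subset n) →
  (∀ {F} → IsFacet Δ F → R F ⊆ F) ×
  (∀ {G} → Face Δ G → ∃! _≡_ λ F → IsFacet Δ F × R F ⊆ G × G ⊆ F)

-- The number of elements of G smaller than v.
#below : Fin n → Subset n → ℕ
#below zero    _       = 0
#below (suc v) (s ∷ G) = if s then suc (#below v G) else #below v G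

module Homology {c ℓ} (R : CommutativeRing c ℓ) where

  open CommutativeRing R using (Carrier; _≈_; 0#; 1#; -_; semiring)
    renaming (_*_ to _·_)
  open import Algebra.Properties.Semiring.Exp semiring using (_^_)
  open import Algebra.Properties.Semiring.Sum semiring using (sum)

  -- An i-chain is given by its coefficients, extended by zero to the
  -- subsets which are not i-dimensional faces.  The degree ranges over ℤ;
  -- the (-1)-chains are supported on the empty face.
  record Chain (Δ : SimplicialComplex n) (i : ℤ) : Set (c ⊔ ℓ) where
    field
      coeff   : Subset n → Carrier
      support : ∀ {G} → ¬ (Face Δ G × dim G ≡ i) → coeff G ≈ 0#

  open Chain public

  -- For v₀ < ⋯ < vᵢ the usual boundary of [v₀,…,vᵢ] is the sum of the
  -- (-1)ʲ [v₀,…,v̂ⱼ,…,vᵢ].  Hence the coefficient of G in the boundary of x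
  -- collects, over all v ∉ G, the coefficient of G ∪ {v} in x, where v is
  -- in position j = #below v G.
  ∂ : (Subset n → Carrier) → (Subset n → Carrier)
  ∂ x G = sum λ v →
    if does (v ∈? G) then 0# else ((- 1#) ^ #below v G) · x (⁅ v ⁆ ∪ G)

  -- The i-th reduced homology of Δ with coefficients in R is zero: every
  -- i-cycle is an i-boundary.
  ReducedHomologyVanishes : SimplicialComplex n → ℤ → Set (c ⊔ ℓ)
  ReducedHomologyVanishes Δ i =
    (z : Chain Δ i) → (∀ G → ∂ (coeff z) G ≈ 0#) →
    ∃ λ (w : Chain Δ (i ℤ.+ 1ℤ)) → ∀ G → ∂ (coeff w) G ≈ coeff z G

-- Classically x # y amounts to x ≉ y, and a HeytingField is just a field.
CohenMacaulay : ∀ {c ℓ₁ ℓ₂} → HeytingField c ℓ₁ ℓ₂ →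
                SimplicialComplex n → Set (c ⊔ ℓ₁)
CohenMacaulay 𝔽 Δ = ∃ λ d → HasRank Δ d ×
  (∀ {F} → Face Δ F → ∀ i → i ≢ + d ℤ.- 1ℤ ℤ.- + ∣ F ∣ →
    ReducedHomologyVanishes (link Δ F) i)
  where open Homology (HeytingCommutativeRing.commutativeRing
                        (HeytingField.heytingCommutativeRing 𝔽))

-- Numbers the elements of W and those of its complement separately.
split : (W : Subset n) → Fin n → Fin ∣ W ∣ ⊎ Fin ∣ ∁ W ∣
split (true  ∷ W) zero    = inj₁ zero
split (false ∷ W) zero    = inj₂ zero
split (true  ∷ W) (suc v) = Sum.map₁ suc (split W v)
split (false ∷ W) (suc v) = Sum.map₂ suc (split W v)

-- The vertex set of the glued complex: W, followed by N copies of ∁ W.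
-- The vertex v in the i-th copy is shared exactly when v ∈ W.
copy : ∀ {N} (W : Subset n) → Fin N → Fin n → Fin (∣ W ∣ + N * ∣ ∁ W ∣)
copy W i v = join ∣ W ∣ _ (Sum.map₂ (combine i) (split W v))

-- N copies of Δ identified along the subcomplex induced on W.  A set is a
-- face when it is contained in the image of a face of some copy.
glue : ∀ N → SimplicialComplex n → (W : Subset n) →
       SimplicialComplex (∣ W ∣ + N * ∣ ∁ W ∣)
glue N Δ W .Face G = ∃₂ λ (i : Fin N) H →
  Face Δ H × Lift (λ x → ∃ λ v → v ∈ H × copy W i v ≡ x) G
glue N Δ W .face? G = any? λ i → anySubset? λ H →
  face? Δ H ×-dec
  Lift? (λ x → any? λ v → (v ∈? H) ×-dec (copy W i v ≟ᶠ x)) G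
glue N Δ W .down-closed G⊆F (i , H , H∈Δ , F⊆copyH) =
  i , H , H∈Δ , λ x∈G → F⊆copyH (G⊆F x∈G)

fromElements : List (Fin n) → Subset n
fromElements = ⋃ ∘ map ⁅_⁆

Q* : SimplicialComplex 14
Q* = generatedBy (map fromElements (
  (# 2 ∷ # 5 ∷ # 6 ∷ # 12 ∷ []) ∷
  (# 1 ∷ # 5 ∷ # 8 ∷ # 11 ∷ []) ∷
  (# 0 ∷ # 1 ∷ # 2 ∷ # 5 ∷ []) ∷
  (# 1 ∷ # 4 ∷ # 8 ∷ # 9 ∷ []) ∷
  (# 1 ∷ # 2 ∷ # 3 ∷ # 10 ∷ []) ∷
  (# 4 ∷ # 5 ∷ # 8 ∷ # 13 ∷ []) ∷
  (# 0 ∷ # 1 ∷ # 2 ∷ # 3 ∷ []) ∷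
  (# 1 ∷ # 4 ∷ # 9 ∷ # 10 ∷ []) ∷
  (# 1 ∷ # 2 ∷ # 9 ∷ # 10 ∷ []) ∷
  (# 1 ∷ # 2 ∷ # 5 ∷ # 6 ∷ []) ∷
  (# 0 ∷ # 2 ∷ # 5 ∷ # 12 ∷ []) ∷
  (# 4 ∷ # 5 ∷ # 7 ∷ # 13 ∷ []) ∷
  (# 1 ∷ # 4 ∷ # 5 ∷ # 8 ∷ []) ∷
  (# 1 ∷ # 2 ∷ # 6 ∷ # 9 ∷ []) ∷
  (# 1 ∷ # 3 ∷ # 4 ∷ # 7 ∷ []) ∷
  (# 1 ∷ # 3 ∷ # 4 ∷ # 10 ∷ []) ∷
  (# 1 ∷ # 5 ∷ # 6 ∷ # 11 ∷ []) ∷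
  (# 1 ∷ # 4 ∷ # 5 ∷ # 7 ∷ []) ∷
  (# 1 ∷ # 6 ∷ # 9 ∷ # 11 ∷ []) ∷
  (# 1 ∷ # 8 ∷ # 9 ∷ # 11 ∷ []) ∷
  []))

-- A* is the subcomplex of Q* induced on this set.
A*-vertices : Subset 14
A*-vertices = fromElements
  (# 0 ∷ # 2 ∷ # 3 ∷ # 4 ∷ # 6 ∷ # 7 ∷ # 8 ∷ # 10 ∷ # 12 ∷ # 13 ∷ [])

C₃₇ : SimplicialComplex 158
C₃₇ = glue 37 Q* A*-vertices

module Submission where

-- C₃₇ is constructible, hence Cohen–Macaulay over any field: Q* and A* are
-- shellable of ranks 4 and 3, and two copies of Q* meet in A*.  The links of a
-- constructible complex have vanishing homology by Mayer–Vietoris.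
--
-- Not partitionable: A* has 36 faces, so among 37 copies some copy has no face
-- of A* in the intervals of its facets, and a partition of C₃₇ restricts
-- to a partition of the faces of Q* outside A* into intervals [r F , F] with
-- r F ∉ A*.  There is none.  {2,6,9} lies only in 1269, which then cannot own
-- {1,2,6} since {2,6} ∈ A*; so 1256 owns it, and 1 ∈ r(1256).  Likewise
-- 1 ∈ r(1458), from {4,8,9} and {1,4,8}.  By {5,6,12} and {5,8,13}, and by the
-- owners of {0,5} and {5,7}, the owner of {2,5}, one of {2,5,6,12}, {0,1,2,5},
-- {0,2,5,12}, must have r F = {5}, and so must the owner of {4,5}, one of
-- {4,5,8,13}, {4,5,7,13}, {1,4,5,7}.  Hence {5} is covered twice.

open import Algebra.Apartness.Bundles
  using (HeytingField; module HeytingCommutativeRing)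
open import Algebra.Bundles using (CommutativeRing)
open import Data.Bool.Base using (true; false; if_then_else_)
import Data.Bool.Properties as Bool
open import Data.Empty using () renaming (⊥ to False)
open import Data.Fin using (#_)
open import Data.Fin.Base
  using (Fin; zero; suc; combine; join; splitAt; remQuot)
import Data.Fin.Properties as Fin
open import Data.Fin.Subset
open import Data.Fin.Subset.Properties
open import Data.Integer.Base as ℤ using (ℤ; +_; 1ℤ)
import Data.Integer.Properties as ℤ
open import Data.Integer.Tactic.RingSolver using (solve-∀)
open import Data.List.Base as List
  using (List; []; _∷_; _++_; allFin; concatMap; deduplicate; filter; foldr; length; map)
open import Data.List.Membership.Propositional using (find) renaming (_∈_ to _∈ₗ_)
open import Data.List.Membership.Propositional.Properties
  using (∈-++⁺ˡ; ∈-++⁺ʳ; ∈-allFin; ∈-concatMap⁺; ∈-deduplicate⁺; ∈-lookup; ∈-map⁺)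
open import Data.List.Properties using (++-identityʳ; map-++)
open import Data.List.Relation.Unary.All as All using (All; []; _∷_)
import Data.List.Relation.Unary.All.Properties as All
open import Data.List.Relation.Unary.AllPairs using (_∷_)
open import Data.List.Relation.Unary.Any as Any using (Any; here; there)
import Data.List.Relation.Unary.Any.Properties as Any
open import Data.List.Relation.Unary.Unique.Propositional using (Unique)
open import Data.List.Relation.Unary.Unique.Propositional.Properties using (allFin⁺)
open import Data.Maybe.Base as Maybe using (Maybe; just; nothing; _>>=_; from-just)
open import Data.Nat.Base as ℕ using (ℕ; zero; suc; _<_)
import Data.Nat.Properties as ℕ
open import Data.Product.Base using (∃; ∃₂; _×_; _,_; proj₁; proj₂)
open import Data.Product using (∃!)
open import Data.Sum.Base as Sum using (_⊎_; inj₁; inj₂; [_,_])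
open import Data.Sum.Properties using (inj₂-injective)
open import Data.Vec.Base as Vec using ([]; _∷_; here; there)
open import Data.Vec.Properties using (≡-dec; []=⇒lookup; lookup⇒[]=; lookup∘tabulate)
open import Function.Base using (_∘_; case_of_)
open import Function.Definitions using (Injective)
open import Relation.Binary.Definitions using (DecidableEquality)
open import Relation.Binary.PropositionalEquality as ≡ using (_≡_; _≢_)
open import Relation.Nullary.Decidable
  using (Dec; does; yes; no; ¬?; _×-dec_; _⊎-dec_; _→-dec_; dec⇒maybe; from-yes; toWitness)
open import Relation.Nullary.Negation using (¬_; contradiction)
open import Defs

private
  variable
    m n d : ℕ

-- Reduced homology

∣⁅v⁆∪p∣≡1+∣p∣ : ∀ {v : Fin n} {p} → v ∉ p → ∣ ⁅ v ⁆ ∪ p ∣ ≡ suc ∣ p ∣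
∣⁅v⁆∪p∣≡1+∣p∣ {v = zero}  {true  ∷ p} v∉p = contradiction here v∉p
∣⁅v⁆∪p∣≡1+∣p∣ {v = zero}  {false ∷ p} v∉p = ≡.cong (suc ∘ ∣_∣) (∪-identityˡ p)
∣⁅v⁆∪p∣≡1+∣p∣ {v = suc v} {true  ∷ p} v∉p =
  ≡.cong suc (∣⁅v⁆∪p∣≡1+∣p∣ (v∉p ∘ there))
∣⁅v⁆∪p∣≡1+∣p∣ {v = suc v} {false ∷ p} v∉p = ∣⁅v⁆∪p∣≡1+∣p∣ (v∉p ∘ there)

dim-⁅v⁆∪ : ∀ {v : Fin n} {G i} → v ∉ G → dim (⁅ v ⁆ ∪ G) ≡ i → dim G ≡ i ℤ.- 1ℤ
dim-⁅v⁆∪ {G = G} v∉G ≡.refl =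
  ≡.cong (λ k → + k ℤ.- 1ℤ ℤ.- 1ℤ) (≡.sym (∣⁅v⁆∪p∣≡1+∣p∣ v∉G))

i-1+1≡i : ∀ i → i ℤ.- 1ℤ ℤ.+ 1ℤ ≡ i
i-1+1≡i i = ≡.trans (ℤ.+-assoc i (ℤ.- 1ℤ) 1ℤ) (ℤ.+-identityʳ i)

module _ {c ℓ} (R : CommutativeRing c ℓ) where

  open CommutativeRing R renaming (_*_ to _·_) hiding (zero)
  open Homology R
  open import Algebra.Properties.Ring ring
    using (-0#≈0#; -1*x≈-x; -‿+-comm; -‿involutive)
  open import Algebra.Properties.Semiring.Exp semiring using (_^_)
  open import Algebra.Properties.Semiring.Sum semiring
    using (sum; sum-cong-≋; sum-replicate-zero; *-distribˡ-sum)
  open import Algebra.Properties.CommutativeSemigroup +-commutativeSemigroup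
    using (interchange)
  open import Relation.Binary.Reasoning.Setoid setoid

  private
    Coeffs : ℕ → Set c
    Coeffs n = Subset n → Carrier

  -- Splitting sets by membership of the vertex `zero` makes identities for `∂` a recursion on `n`.
  -- Here `zero` is added with sign +1 and, being absent, shifts no other sign.
  ∂-outside : ∀ (x : Coeffs (suc n)) G →
    ∂ x (false ∷ G) ≈ x (true ∷ G) + ∂ (x ∘ (false ∷_)) G
  ∂-outside x G = +-cong
    (trans (*-identityˡ _)
      (reflexive (≡.cong (λ H → x (true ∷ H)) (∪-identityˡ G))))
    refl

  -- Now `zero` is in the set and below every other vertex, so each sign gains one factor -1.
  ∂-inside : ∀ (x : Coeffs (suc n)) G →
    ∂ x (true ∷ G) ≈ - ∂ (x ∘ (true ∷_)) G
  ∂-inside {n} x G = begin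
    ∂ x (true ∷ G)
      ≈⟨ +-identityˡ _ ⟩
    sum (λ v → if does (v ∈? G) then 0# else (- 1# · sign v) · xᵥ v)
      ≈⟨ sum-cong-≋ (λ v → factor (does (v ∈? G)) (sign v) (xᵥ v)) ⟩
    sum (λ v → - 1# · (if does (v ∈? G) then 0# else sign v · xᵥ v))
      ≈⟨ *-distribˡ-sum {n = n} _ _ ⟨
    - 1# · ∂ (x ∘ (true ∷_)) G
      ≈⟨ -1*x≈-x _ ⟩
    - ∂ (x ∘ (true ∷_)) G
      ∎
    where
    sign xᵥ : Fin n → Carrier
    sign v = (- 1#) ^ #below v G
    xᵥ v = x (true ∷ ⁅ v ⁆ ∪ G)
    factor : ∀ b s y → (if b then 0# else (- 1# · s) · y) ≈
                       - 1# · (if b then 0# else s · y)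
    factor true  s y = sym (zeroʳ _)
    factor false s y = *-assoc _ _ _

  ∂-cong : ∀ {x y : Coeffs n} → (∀ G → x G ≈ y G) → ∀ G → ∂ x G ≈ ∂ y G
  ∂-cong x≈y G = sum-cong-≋ λ v → if-cong (does (v ∈? G)) (*-congˡ (x≈y _))
    where
    if-cong : ∀ b {s t} → s ≈ t → (if b then 0# else s) ≈ (if b then 0# else t)
    if-cong true  s≈t = refl
    if-cong false s≈t = s≈t

  ∂-vanishes : ∀ (x : Coeffs n) G →
    (∀ {v} → v ∉ G → x (⁅ v ⁆ ∪ G) ≈ 0#) → ∂ x G ≈ 0#
  ∂-vanishes {n} x G x≈0 = trans (sum-cong-≋ term) (sum-replicate-zero n)
    where
    term : ∀ v → (if does (v ∈? G) then 0# else
                   ((- 1#) ^ #below v G) · x (⁅ v ⁆ ∪ G)) ≈ 0#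
    term v with v ∈? G
    ... | yes _  = refl
    ... | no v∉G = trans (*-congˡ (x≈0 v∉G)) (zeroʳ _)

  ∂0≈0 : ∀ (G : Subset n) → ∂ (λ _ → 0#) G ≈ 0#
  ∂0≈0 G = ∂-vanishes (λ _ → 0#) G λ _ → refl

  ∂-+ : ∀ (x y : Coeffs n) G → ∂ (λ H → x H + y H) G ≈ ∂ x G + ∂ y G
  ∂-+ x y []          = sym (+-identityˡ 0#)
  ∂-+ x y (false ∷ G) = begin
    ∂ (λ H → x H + y H) (false ∷ G)
      ≈⟨ ∂-outside (λ H → x H + y H) G ⟩
    (x (true ∷ G) + y (true ∷ G)) + ∂ (λ H → x (false ∷ H) + y (false ∷ H)) G
      ≈⟨ +-congˡ (∂-+ (x ∘ (false ∷_)) (y ∘ (false ∷_)) G) ⟩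
    (x (true ∷ G) + y (true ∷ G)) + (∂ (x ∘ (false ∷_)) G + ∂ (y ∘ (false ∷_)) G)
      ≈⟨ interchange _ _ _ _ ⟩
    (x (true ∷ G) + ∂ (x ∘ (false ∷_)) G) + (y (true ∷ G) + ∂ (y ∘ (false ∷_)) G)
      ≈⟨ +-cong (∂-outside x G) (∂-outside y G) ⟨
    ∂ x (false ∷ G) + ∂ y (false ∷ G) ∎
  ∂-+ x y (true ∷ G) = begin
    ∂ (λ H → x H + y H) (true ∷ G)                    ≈⟨ ∂-inside (λ H → x H + y H) G ⟩
    - ∂ (λ H → x (true ∷ H) + y (true ∷ H)) G
      ≈⟨ -‿cong (∂-+ (x ∘ (true ∷_)) (y ∘ (true ∷_)) G) ⟩
    - (∂ (x ∘ (true ∷_)) G + ∂ (y ∘ (true ∷_)) G)     ≈⟨ -‿+-comm _ _ ⟨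
    - ∂ (x ∘ (true ∷_)) G + - ∂ (y ∘ (true ∷_)) G     ≈⟨ +-cong (∂-inside x G) (∂-inside y G) ⟨
    ∂ x (true ∷ G) + ∂ y (true ∷ G)                   ∎

  ∂-neg : ∀ (x : Coeffs n) G → ∂ (λ H → - x H) G ≈ - ∂ x G
  ∂-neg x []          = sym -0#≈0#
  ∂-neg x (false ∷ G) = begin
    ∂ (λ H → - x H) (false ∷ G)                         ≈⟨ ∂-outside (λ H → - x H) G ⟩
    - x (true ∷ G) + ∂ (λ H → - x (false ∷ H)) G        ≈⟨ +-congˡ (∂-neg (x ∘ (false ∷_)) G) ⟩
    - x (true ∷ G) + - ∂ (x ∘ (false ∷_)) G             ≈⟨ -‿+-comm _ _ ⟩
    - (x (true ∷ G) + ∂ (x ∘ (false ∷_)) G)             ≈⟨ -‿cong (∂-outside x G) ⟨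
    - ∂ x (false ∷ G)                                   ∎
  ∂-neg x (true ∷ G) = begin
    ∂ (λ H → - x H) (true ∷ G)         ≈⟨ ∂-inside (λ H → - x H) G ⟩
    - ∂ (λ H → - x (true ∷ H)) G       ≈⟨ -‿cong (∂-neg (x ∘ (true ∷_)) G) ⟩
    - - ∂ (x ∘ (true ∷_)) G            ≈⟨ -‿cong (∂-inside x G) ⟨
    - ∂ x (true ∷ G)                   ∎

  -- On sets without `zero`, the boundary of the part of `x` containing `zero` occurs twice, once
  -- negated by `∂-inside` and once through linearity, and cancels. The rest is the recursive call.
  ∂∂≈0 : ∀ (x : Coeffs n) G → ∂ (∂ x) G ≈ 0#
  ∂∂≈0 x []          = refl
  ∂∂≈0 x (false ∷ G) = begin
    ∂ (∂ x) (false ∷ G)                                    ≈⟨ ∂-outside (∂ x) G ⟩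
    ∂ x (true ∷ G) + ∂ (∂ x ∘ (false ∷_)) G
      ≈⟨ +-cong (∂-inside x G) (∂-cong (∂-outside x) G) ⟩
    - ∂x₁ + ∂ (λ H → x (true ∷ H) + ∂ (x ∘ (false ∷_)) H) G
      ≈⟨ +-congˡ (∂-+ (x ∘ (true ∷_)) (∂ (x ∘ (false ∷_))) G) ⟩
    - ∂x₁ + (∂x₁ + ∂ (∂ (x ∘ (false ∷_))) G)
      ≈⟨ +-congˡ (+-congˡ (∂∂≈0 (x ∘ (false ∷_)) G)) ⟩
    - ∂x₁ + (∂x₁ + 0#)                                     ≈⟨ +-congˡ (+-identityʳ _) ⟩
    - ∂x₁ + ∂x₁                                            ≈⟨ -‿inverseˡ _ ⟩
    0#                                                     ∎
    where ∂x₁ = ∂ (x ∘ (true ∷_)) G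
  ∂∂≈0 x (true ∷ G) = begin
    ∂ (∂ x) (true ∷ G)                     ≈⟨ ∂-inside (∂ x) G ⟩
    - ∂ (∂ x ∘ (true ∷_)) G                ≈⟨ -‿cong (∂-cong (∂-inside x) G) ⟩
    - ∂ (λ H → - ∂ (x ∘ (true ∷_)) H) G    ≈⟨ -‿cong (∂-neg (∂ (x ∘ (true ∷_))) G) ⟩
    - - ∂ (∂ (x ∘ (true ∷_))) G            ≈⟨ -‿cong (-‿cong (∂∂≈0 (x ∘ (true ∷_)) G)) ⟩
    - - 0#                                 ≈⟨ -‿involutive 0# ⟩
    0#                                     ∎

  -- Cone from the first vertex of S.
  simplex-acyclic : ∀ {S : Subset n} → Nonempty S →
    ∀ {D D′ : ℕ → Set} → (∀ {k} → D k → D′ (suc k)) →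
    ∀ x → (∀ {G} → ¬ (G ⊆ S × D ∣ G ∣) → x G ≈ 0#) → (∀ G → ∂ x G ≈ 0#) →
    ∃ λ (w : Coeffs n) →
      (∀ {G} → ¬ (G ⊆ S × D′ ∣ G ∣) → w G ≈ 0#) × (∀ G → ∂ w G ≈ x G)
  simplex-acyclic {n = suc n} {true ∷ S} _ {D} {D′} D⇒D′ x supp ∂x≈0 =
      w
    , w-supp
    , ∂w≈x
    where
    w : Coeffs (suc n)
    w (true  ∷ G) = x (false ∷ G)
    w (false ∷ G) = 0#
    w-supp : ∀ {G} → ¬ (G ⊆ true ∷ S × D′ ∣ G ∣) → w G ≈ 0#
    w-supp {true  ∷ G} ¬G = supp λ (G⊆S , DG) →
      ¬G (in⊆in (drop-∷-⊆ G⊆S) , D⇒D′ DG)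
    w-supp {false ∷ G} ¬G = refl
    ∂w≈x : ∀ G → ∂ w G ≈ x G
    ∂w≈x (false ∷ G) = begin
      ∂ w (false ∷ G)                    ≈⟨ ∂-outside w G ⟩
      x (false ∷ G) + ∂ (λ _ → 0#) G     ≈⟨ +-congˡ (∂0≈0 G) ⟩
      x (false ∷ G) + 0#                 ≈⟨ +-identityʳ _ ⟩
      x (false ∷ G)                      ∎
    -- On sets containing the apex, the equation amounts to the cycle condition for `x` on the same
    -- set without the apex.
    ∂w≈x (true ∷ G) = begin
      ∂ w (true ∷ G)                     ≈⟨ ∂-inside w G ⟩
      - ∂x₀                              ≈⟨ +-identityˡ _ ⟨
      0# + - ∂x₀                         ≈⟨ +-congʳ (∂x≈0 (false ∷ G)) ⟨
      ∂ x (false ∷ G) + - ∂x₀            ≈⟨ +-congʳ (∂-outside x G) ⟩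
      (x (true ∷ G) + ∂x₀) + - ∂x₀       ≈⟨ +-assoc _ _ _ ⟩
      x (true ∷ G) + (∂x₀ + - ∂x₀)       ≈⟨ +-congˡ (-‿inverseʳ _) ⟩
      x (true ∷ G) + 0#                  ≈⟨ +-identityʳ _ ⟩
      x (true ∷ G)                       ∎
      where ∂x₀ = ∂ (x ∘ (false ∷_)) G
  simplex-acyclic {n = suc n} {false ∷ S} (suc v , there v∈S) {D} {D′} D⇒D′ x supp ∂x≈0 =
      w
    , w-supp
    , ∂w≈x
    where
    x₁≈0 : ∀ G → x (true ∷ G) ≈ 0#
    x₁≈0 G = supp λ (G⊆S , _) → case G⊆S here of λ ()
    rec : _
    rec = simplex-acyclic (v , v∈S) {D} {D′} D⇒D′ (x ∘ (false ∷_))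
      (λ ¬G → supp λ (G⊆S , DG) → ¬G (drop-∷-⊆ G⊆S , DG))
      (λ G → begin
        ∂ (x ∘ (false ∷_)) G                 ≈⟨ +-identityˡ _ ⟨
        0# + ∂ (x ∘ (false ∷_)) G            ≈⟨ +-congʳ (x₁≈0 G) ⟨
        x (true ∷ G) + ∂ (x ∘ (false ∷_)) G  ≈⟨ ∂-outside x G ⟨
        ∂ x (false ∷ G)                      ≈⟨ ∂x≈0 _ ⟩
        0#                                   ∎)
    w : Coeffs (suc n)
    w (true  ∷ G) = 0#
    w (false ∷ G) = proj₁ rec G
    w-supp : ∀ {G} → ¬ (G ⊆ false ∷ S × D′ ∣ G ∣) → w G ≈ 0#
    w-supp {true  ∷ G} ¬G = refl
    w-supp {false ∷ G} ¬G = proj₁ (proj₂ rec) λ (G⊆S , DG) → ¬G (out⊆ G⊆S , DG)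
    ∂w≈x : ∀ G → ∂ w G ≈ x G
    ∂w≈x (false ∷ G) = begin
      ∂ w (false ∷ G)           ≈⟨ ∂-outside w G ⟩
      0# + ∂ (proj₁ rec) G      ≈⟨ +-identityˡ _ ⟩
      ∂ (proj₁ rec) G           ≈⟨ proj₂ (proj₂ rec) G ⟩
      x (false ∷ G)             ∎
    ∂w≈x (true ∷ G) = begin
      ∂ w (true ∷ G)      ≈⟨ ∂-inside w G ⟩
      - ∂ (λ _ → 0#) G    ≈⟨ -‿cong (∂0≈0 G) ⟩
      - 0#                ≈⟨ -0#≈0# ⟩
      0#                  ≈⟨ x₁≈0 G ⟨
      x (true ∷ G)        ∎

  vanishes-respects-⇔ : ∀ {Δ Δ′ : SimplicialComplex n} {i} →
    (∀ {G} → Face Δ G → Face Δ′ G) → (∀ {G} → Face Δ′ G → Face Δ G) →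
    ReducedHomologyVanishes Δ i → ReducedHomologyVanishes Δ′ i
  vanishes-respects-⇔ Δ⊆Δ′ Δ′⊆Δ van z ∂z≈0 =
    let w , ∂w≈z = van
          (record { coeff = coeff z
                  ; support = λ ¬G → support z λ (G∈Δ′ , e) → ¬G (Δ′⊆Δ G∈Δ′ , e) })
          ∂z≈0
    in record { coeff = coeff w
              ; support = λ ¬G → support w λ (G∈Δ , e) → ¬G (Δ⊆Δ′ G∈Δ , e) }
     , ∂w≈z

  vanishes-without-faces : ∀ {Δ : SimplicialComplex n} {i} →
    (∀ {G} → Face Δ G → dim G ≢ i) → ReducedHomologyVanishes Δ i
  vanishes-without-faces none z _ =
      record { coeff = λ _ → 0# ; support = λ _ → refl }
    , λ G → trans (∂0≈0 G)
                  (sym (support z λ (G∈Δ , e) → none G∈Δ e))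

  -- The part of the Mayer–Vietoris sequence
  -- H̃ᵢ(Δ₁) ⊕ H̃ᵢ(Δ₂) → H̃ᵢ(Δ₁ ∪ Δ₂) → H̃ᵢ₋₁(Δ₁ ∩ Δ₂).
  mayer-vietoris : ∀ {Δ Δ₁ Δ₂ Γ : SimplicialComplex n} {i} →
    (∀ {G} → Face Δ G → Face Δ₁ G ⊎ Face Δ₂ G) →
    (∀ {G} → Face Δ₁ G → Face Δ G) → (∀ {G} → Face Δ₂ G → Face Δ G) →
    (∀ {G} → Face Δ₁ G → Face Δ₂ G → Face Γ G) →
    (∀ {G} → Face Γ G → Face Δ₁ G) → (∀ {G} → Face Γ G → Face Δ₂ G) →
    ReducedHomologyVanishes Δ₁ i → ReducedHomologyVanishes Δ₂ i →
    ReducedHomologyVanishes Γ (i ℤ.- 1ℤ) → ReducedHomologyVanishes Δ i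
  mayer-vietoris {n} {Δ} {Δ₁} {Δ₂} {Γ} {i} Δ⊆Δ₁∪Δ₂ Δ₁⊆Δ Δ₂⊆Δ Δ₁∩Δ₂⊆Γ Γ⊆Δ₁ Γ⊆Δ₂
    van₁ van₂ vanΓ z ∂z≈0 =
      record
        { coeff   = λ G → coeff y₁ G + coeff y₂ G
        ; support = λ ¬G → trans
            (+-cong (support y₁ λ (G∈Δ₁ , e) → ¬G (Δ₁⊆Δ G∈Δ₁ , e))
                    (support y₂ λ (G∈Δ₂ , e) → ¬G (Δ₂⊆Δ G∈Δ₂ , e)))
            (+-identityˡ 0#)
        }
    , λ G → begin
        ∂ (λ H → coeff y₁ H + coeff y₂ H) G   ≈⟨ ∂-+ (coeff y₁) (coeff y₂) G ⟩
        ∂ (coeff y₁) G + ∂ (coeff y₂) G       ≈⟨ +-cong (∂y₁≈u₁ G) (∂y₂≈u₂ G) ⟩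
        (z₁ G + - w G) + (z₂ G + w G)         ≈⟨ interchange _ _ _ _ ⟩
        (z₁ G + z₂ G) + (- w G + w G)         ≈⟨ +-cong (z₁+z₂≈z G) (-‿inverseˡ _) ⟩
        coeff z G + 0#                        ≈⟨ +-identityʳ _ ⟩
        coeff z G                             ∎
    where
    -- The faces common to both pieces go to `z₁`; decidability of faces makes the cut possible.
    z₁ z₂ : Coeffs n
    z₁ G = if does (face? Δ₁ G) then coeff z G else 0#
    z₂ G = if does (face? Δ₁ G) then 0# else coeff z G

    z₁-supp : ∀ {G} → ¬ (Face Δ₁ G × dim G ≡ i) → z₁ G ≈ 0#
    z₁-supp {G} ¬G with face? Δ₁ G
    ... | yes G∈Δ₁ = support z λ (_ , e) → ¬G (G∈Δ₁ , e)
    ... | no  _    = refl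

    z₂-supp : ∀ {G} → ¬ (Face Δ₂ G × dim G ≡ i) → z₂ G ≈ 0#
    z₂-supp {G} ¬G with face? Δ₁ G
    ... | yes _    = refl
    ... | no  G∉Δ₁ = support z λ (G∈Δ , e) → case Δ⊆Δ₁∪Δ₂ G∈Δ of λ where
      (inj₁ G∈Δ₁) → G∉Δ₁ G∈Δ₁
      (inj₂ G∈Δ₂) → ¬G (G∈Δ₂ , e)

    z₁+z₂≈z : ∀ G → z₁ G + z₂ G ≈ coeff z G
    z₁+z₂≈z G with does (face? Δ₁ G)
    ... | true  = +-identityʳ _
    ... | false = +-identityˡ _

    ∂z₁+∂z₂≈0 : ∀ G → ∂ z₁ G + ∂ z₂ G ≈ 0#
    ∂z₁+∂z₂≈0 G = begin
      ∂ z₁ G + ∂ z₂ G            ≈⟨ ∂-+ z₁ z₂ G ⟨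
      ∂ (λ H → z₁ H + z₂ H) G    ≈⟨ ∂-cong z₁+z₂≈z G ⟩
      ∂ (coeff z) G              ≈⟨ ∂z≈0 G ⟩
      0#                         ∎

    ∂-supp : ∀ (Θ : SimplicialComplex n) {x} →
      (∀ {G} → ¬ (Face Θ G × dim G ≡ i) → x G ≈ 0#) →
      ∀ {G} → ¬ (Face Θ G × dim G ≡ i ℤ.- 1ℤ) → ∂ x G ≈ 0#
    ∂-supp Θ {x} supp {G} ¬G = ∂-vanishes x G λ {v} v∉G → supp λ (vG∈Θ , e) →
      ¬G (down-closed Θ (q⊆p∪q ⁅ v ⁆ G) vG∈Θ , dim-⁅v⁆∪ v∉G e)

    -- Since `∂ z₁` is the negative of `∂ z₂`, it is supported on both pieces, hence on `Γ`, where
    -- it can be filled.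
    ∂z₁-supp : ∀ {G} → ¬ (Face Γ G × dim G ≡ i ℤ.- 1ℤ) → ∂ z₁ G ≈ 0#
    ∂z₁-supp {G} ¬G with face? Δ₁ G
    ... | no  G∉Δ₁ = ∂-supp Δ₁ z₁-supp λ (G∈Δ₁ , _) → G∉Δ₁ G∈Δ₁
    ... | yes G∈Δ₁ = begin
      ∂ z₁ G              ≈⟨ +-identityʳ _ ⟨
      ∂ z₁ G + 0#         ≈⟨ +-congˡ ∂z₂≈0 ⟨
      ∂ z₁ G + ∂ z₂ G     ≈⟨ ∂z₁+∂z₂≈0 G ⟩
      0#                  ∎
      where
      ∂z₂≈0 : ∂ z₂ G ≈ 0#
      ∂z₂≈0 = ∂-supp Δ₂ z₂-supp λ (G∈Δ₂ , e) → ¬G (Δ₁∩Δ₂⊆Γ G∈Δ₁ G∈Δ₂ , e)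

    filling : _
    filling = vanΓ (record { coeff = ∂ z₁ ; support = ∂z₁-supp }) (∂∂≈0 z₁)

    -- Shifting `w` from one part to the other turns both into cycles: `z₁ - w` on `Δ₁` and `z₂ + w`
    -- on `Δ₂`.
    w : Coeffs n
    w = coeff (proj₁ filling)

    ∂w≈∂z₁ : ∀ G → ∂ w G ≈ ∂ z₁ G
    ∂w≈∂z₁ = proj₂ filling

    w-supp : ∀ {G} → ¬ (Face Γ G × dim G ≡ i) → w G ≈ 0#
    w-supp ¬G = support (proj₁ filling) λ (G∈Γ , e) →
      ¬G (G∈Γ , ≡.trans e (i-1+1≡i i))

    filling₁ : _
    filling₁ = van₁
      (record
        { coeff   = λ G → z₁ G + - w G
        ; support = λ ¬G → trans
            (+-cong (z₁-supp ¬G)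
              (trans (-‿cong (w-supp λ (G∈Γ , e) → ¬G (Γ⊆Δ₁ G∈Γ , e))) -0#≈0#))
            (+-identityˡ 0#)
        })
      (λ G → begin
        ∂ (λ H → z₁ H + - w H) G       ≈⟨ ∂-+ z₁ (λ H → - w H) G ⟩
        ∂ z₁ G + ∂ (λ H → - w H) G     ≈⟨ +-congˡ (∂-neg w G) ⟩
        ∂ z₁ G + - ∂ w G               ≈⟨ +-congˡ (-‿cong (∂w≈∂z₁ G)) ⟩
        ∂ z₁ G + - ∂ z₁ G              ≈⟨ -‿inverseʳ _ ⟩
        0#                             ∎)

    filling₂ : _
    filling₂ = van₂
      (record
        { coeff   = λ G → z₂ G + w G
        ; support = λ ¬G → trans
            (+-cong (z₂-supp ¬G) (w-supp λ (G∈Γ , e) → ¬G (Γ⊆Δ₂ G∈Γ , e)))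
            (+-identityˡ 0#)
        })
      (λ G → begin
        ∂ (λ H → z₂ H + w H) G    ≈⟨ ∂-+ z₂ w G ⟩
        ∂ z₂ G + ∂ w G            ≈⟨ +-congˡ (∂w≈∂z₁ G) ⟩
        ∂ z₂ G + ∂ z₁ G           ≈⟨ +-comm _ _ ⟩
        ∂ z₁ G + ∂ z₂ G           ≈⟨ ∂z₁+∂z₂≈0 G ⟩
        0#                        ∎)

    y₁ = proj₁ filling₁
    y₂ = proj₁ filling₂
    ∂y₁≈u₁ = proj₂ filling₁
    ∂y₂≈u₂ = proj₂ filling₂

-- Constructible complexes

_≟ˢ_ : DecidableEquality (Subset n)
_≟ˢ_ = ≡-dec Bool._≟_

image : (Fin n → Fin m) → Subset n → Subset m
image f []          = ⊥
image f (true  ∷ p) = ⁅ f zero ⁆ ∪ image (f ∘ suc) p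
image f (false ∷ p) = image (f ∘ suc) p

∈-image⁺ : ∀ (f : Fin n → Fin m) {v p} → v ∈ p → f v ∈ image f p
∈-image⁺ f {zero}  {true  ∷ p} here        = p⊆p∪q _ (x∈⁅x⁆ (f zero))
∈-image⁺ f {suc v} {true  ∷ p} (there v∈p) = q⊆p∪q ⁅ f zero ⁆ _ (∈-image⁺ (f ∘ suc) v∈p)
∈-image⁺ f {suc v} {false ∷ p} (there v∈p) = ∈-image⁺ (f ∘ suc) v∈p

∈-image⁻ : ∀ (f : Fin n → Fin m) {x} p → x ∈ image f p → ∃ λ v → v ∈ p × f v ≡ x
∈-image⁻ f []          x∈ = contradiction x∈ ∉⊥
∈-image⁻ f (true  ∷ p) x∈ with x∈p∪q⁻ ⁅ f zero ⁆ _ x∈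
... | inj₁ x∈⁅f0⁆ = zero , here , ≡.sym (x∈⁅y⁆⇒x≡y _ x∈⁅f0⁆)
... | inj₂ x∈im   = let v , v∈p , e = ∈-image⁻ (f ∘ suc) p x∈im in suc v , there v∈p , e
∈-image⁻ f (false ∷ p) x∈ = let v , v∈p , e = ∈-image⁻ (f ∘ suc) p x∈ in suc v , there v∈p , e

image-mono : ∀ (f : Fin n → Fin m) {p q} → p ⊆ q → image f p ⊆ image f q
image-mono f {p} p⊆q x∈ with ∈-image⁻ f p x∈
... | v , v∈p , ≡.refl = ∈-image⁺ f (p⊆q v∈p)

module _ {f : Fin n → Fin m} (inj : Injective _≡_ _≡_ f) where

  image-reflects-⊆ : ∀ {p q} → image f p ⊆ image f q → p ⊆ q
  image-reflects-⊆ {p} {q} fp⊆fq v∈p with ∈-image⁻ f q (fp⊆fq (∈-image⁺ f v∈p))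
  ... | w , w∈q , e with inj e
  ... | ≡.refl = w∈q

  image-injective : ∀ {p q} → image f p ≡ image f q → p ≡ q
  image-injective e = ⊆-antisym
    (image-reflects-⊆ (⊆-reflexive e)) (image-reflects-⊆ (⊆-reflexive (≡.sym e)))

  image-∩-⊆ : ∀ p q → image f p ∩ image f q ⊆ image f (p ∩ q)
  image-∩-⊆ p q x∈ with x∈p∩q⁻ (image f p) _ x∈
  ... | x∈fp , x∈fq with ∈-image⁻ f p x∈fp | ∈-image⁻ f q x∈fq
  ... | v , v∈p , ≡.refl | w , w∈q , e with inj e
  ... | ≡.refl = ∈-image⁺ f (x∈p∩q⁺ (v∈p , w∈q))

∣image∣ : ∀ {f : Fin n → Fin m} → Injective _≡_ _≡_ f → ∀ p → ∣ image f p ∣ ≡ ∣ p ∣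
∣image∣ {m = m} inj [] = ∣⊥∣≡0 m
∣image∣ {f = f} inj (true ∷ p) = ≡.trans
  (∣⁅v⁆∪p∣≡1+∣p∣ λ f0∈ → let _ , _ , e = ∈-image⁻ (f ∘ suc) p f0∈ in
                          case inj e of λ ())
  (≡.cong suc (∣image∣ (λ e → case inj e of λ where ≡.refl → ≡.refl) p))
∣image∣ inj (false ∷ p) = ∣image∣ (λ e → case inj e of λ where ≡.refl → ≡.refl) p

-- Complexes are given by generating faces, and the index is the rank. The last three hypotheses of
-- `union` say that `Hs` generates the intersection of the complexes generated by `Fs` and `Gs`.
data Constructible {n} : ℕ → List (Subset n) → Set where
  simplex : ∀ {d F} → ∣ F ∣ ≡ d → Constructible d (F ∷ [])
  union   : ∀ {d Fs Gs Hs} →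
    Constructible (suc d) Fs → Constructible (suc d) Gs → Constructible d Hs →
    All (λ F → All (λ G → Any (F ∩ G ⊆_) Hs) Gs) Fs →
    All (λ H → Any (H ⊆_) Fs) Hs → All (λ H → Any (H ⊆_) Gs) Hs →
    Constructible (suc d) (Fs ++ Gs)

any-⊆-antimono : ∀ {p q : Subset n} {Hs} → p ⊆ q → Any (q ⊆_) Hs → Any (p ⊆_) Hs
any-⊆-antimono {p = p} {q} p⊆q =
  Any.map {P = q ⊆_} {Q = p ⊆_} λ q⊆H x∈p → q⊆H (p⊆q x∈p)

any-⊆-trans : ∀ {K : Subset n} {Fs Gs} →
  All (λ F → Any (F ⊆_) Gs) Fs → Any (K ⊆_) Fs → Any (K ⊆_) Gs
any-⊆-trans {K = K} (F⊆Gs ∷ _) (here K⊆F) = any-⊆-antimono K⊆F F⊆Gs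
any-⊆-trans (_ ∷ Fs⊆Gs) (there K⊆Fs) = any-⊆-trans Fs⊆Gs K⊆Fs

any-⊆-∩ : ∀ {K : Subset n} {Fs Gs Hs} →
  All (λ F → All (λ G → Any (F ∩ G ⊆_) Hs) Gs) Fs →
  Any (K ⊆_) Fs → Any (K ⊆_) Gs → Any (K ⊆_) Hs
any-⊆-∩ {K = K} {Hs = Hs} (F∩Gs⊆Hs ∷ _) (here {F} K⊆F) K⊆Gs = go F∩Gs⊆Hs K⊆Gs
  where
  go : ∀ {Gs} → All (λ G → Any (F ∩ G ⊆_) Hs) Gs → Any (K ⊆_) Gs → Any (K ⊆_) Hs
  go (F∩G⊆Hs ∷ _) (here {G} K⊆G) =
    any-⊆-antimono (λ x∈K → x∈p∩q⁺ (K⊆F x∈K , K⊆G x∈K)) F∩G⊆Hs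
  go (_ ∷ rest) (there K⊆Gs) = go rest K⊆Gs
any-⊆-∩ (_ ∷ rest) (there K⊆Fs) K⊆Gs = any-⊆-∩ rest K⊆Fs K⊆Gs

-- Links of constructible complexes

link-simplex-⊆ : ∀ {F G K : Subset n} →
  Face (link (generatedBy (F ∷ [])) G) K → K ⊆ F ∩ ∁ G
link-simplex-⊆ {G = G} (K∩G=∅ , here K∪G⊆F) {x} x∈K = x∈p∩q⁺
  (K∪G⊆F (p⊆p∪q G x∈K) , x∉p⇒x∈∁p λ x∈G → K∩G=∅ (x , x∈p∩q⁺ (x∈K , x∈G)))

module _ {c ℓ} (R : CommutativeRing c ℓ) where
  open Homology R

  -- The link is void if `G ⊈ F`. If `G ≡ F` it consists of the empty face, and -1 is the excluded
  -- degree. Otherwise it is the full simplex on the nonempty set `F ∩ ∁ G`, which is acyclic.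
  link-simplex-vanishes : ∀ (F G : Subset n) i → i ≢ + ∣ F ∣ ℤ.- 1ℤ ℤ.- + ∣ G ∣ →
    ReducedHomologyVanishes (link (generatedBy (F ∷ [])) G) i
  link-simplex-vanishes {n} F G i i≢ with G ⊆? F | nonempty? (F ∩ ∁ G)
  ... | no  G⊈F | _ = vanishes-without-faces R λ {K} → λ where
    (_ , here K∪G⊆F) → contradiction (λ {x} x∈G → K∪G⊆F (q⊆p∪q K G x∈G)) G⊈F
  ... | yes G⊆F | no F∩∁G=∅ = vanishes-without-faces R λ {K} K∈lk e →
    i≢ (≡.trans (≡.sym e) (≡.trans
      (≡.cong dim (Empty-unique λ (x , x∈K) → F∩∁G=∅ (x , link-simplex-⊆ K∈lk x∈K)))
      (≡.trans (≡.cong (λ k → + k ℤ.- 1ℤ) (∣⊥∣≡0 n))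
      (≡.trans (lemma (+ ∣ F ∣))
        (≡.cong (λ p → + ∣ F ∣ ℤ.- 1ℤ ℤ.- + ∣ p ∣) (⊆-antisym F⊆G G⊆F))))))
    where
    F⊆G : F ⊆ G
    F⊆G {x} x∈F with x ∈? G
    ... | yes x∈G = x∈G
    ... | no  x∉G = contradiction (x , x∈p∩q⁺ (x∈F , x∉p⇒x∈∁p x∉G)) F∩∁G=∅
    lemma : ∀ k → + 0 ℤ.- 1ℤ ≡ k ℤ.- 1ℤ ℤ.- k
    lemma = solve-∀
  ... | yes G⊆F | yes ne = λ z ∂z≈0 →
    let w , w-supp , ∂w≈z = simplex-acyclic R ne
          {λ k → + k ℤ.- 1ℤ ≡ i} {λ k → + k ℤ.- 1ℤ ≡ i ℤ.+ 1ℤ}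
          (λ {k} e → ≡.trans (≡.sym (i-1+1≡i (+ k))) (≡.cong (ℤ._+ 1ℤ) e))
          (coeff z)
          (λ ¬K → support z λ (K∈lk , e) → ¬K (link-simplex-⊆ K∈lk , e))
          ∂z≈0
    in record { coeff = w
              ; support = λ ¬K → w-supp λ (K⊆ , e) → ¬K (⊆link K⊆ , e) }
     , ∂w≈z
    where
    ⊆link : ∀ {K} → K ⊆ F ∩ ∁ G → Face (link (generatedBy (F ∷ [])) G) K
    ⊆link {K} K⊆ =
        (λ (x , x∈K∩G) → let x∈K , x∈G = x∈p∩q⁻ K G x∈K∩G in
          x∈∁p⇒x∉p (proj₂ (x∈p∩q⁻ F _ (K⊆ x∈K))) x∈G)
      , here (λ {x} x∈K∪G → [ (λ x∈K → proj₁ (x∈p∩q⁻ F (∁ G) (K⊆ x∈K))) , (λ x∈G → G⊆F x∈G) ]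
                        (x∈p∪q⁻ K G x∈K∪G))

  -- Taking links commutes with unions and intersections, so Mayer-Vietoris applies to the links.
  -- The intersection has rank one less, which matches the drop of the degree to `i - 1`.
  link-vanishes : ∀ {Fs : List (Subset n)} → Constructible d Fs →
    ∀ G i → i ≢ + d ℤ.- 1ℤ ℤ.- + ∣ G ∣ →
    ReducedHomologyVanishes (link (generatedBy Fs) G) i
  link-vanishes (simplex {F = F} ≡.refl) G i i≢ = link-simplex-vanishes F G i i≢
  link-vanishes (union {d} {Fs} {Gs} {Hs} cFs cGs cHs Fs∩Gs⊆Hs Hs⊆Fs Hs⊆Gs) G i i≢ =
    mayer-vietoris R {Γ = link (generatedBy Hs) G}
      (λ (e , K∈) → [ (λ K∈Fs → inj₁ (e , K∈Fs)) , (λ K∈Gs → inj₂ (e , K∈Gs)) ]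
                      (Any.++⁻ Fs K∈))
      (λ (e , K∈) → e , Any.++⁺ˡ K∈)
      (λ (e , K∈) → e , Any.++⁺ʳ Fs K∈)
      (λ (e , K∈Fs) (_ , K∈Gs) → e , any-⊆-∩ Fs∩Gs⊆Hs K∈Fs K∈Gs)
      (λ (e , K∈) → e , any-⊆-trans Hs⊆Fs K∈)
      (λ (e , K∈) → e , any-⊆-trans Hs⊆Gs K∈)
      (link-vanishes cFs G i i≢)
      (link-vanishes cGs G i i≢)
      (link-vanishes cHs G (i ℤ.- 1ℤ) λ e → i≢
        (≡.trans (≡.sym (i-1+1≡i i)) (≡.trans (≡.cong (ℤ._+ 1ℤ) e) (lemma (+ d) (+ ∣ G ∣)))))
    where
    lemma : ∀ a k → a ℤ.- 1ℤ ℤ.- k ℤ.+ 1ℤ ≡ a ℤ.- k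
    lemma = solve-∀

any-⊆-map-image : ∀ (f : Fin n → Fin m) {p Fs} →
  Any (p ⊆_) Fs → Any (image f p ⊆_) (map (image f) Fs)
any-⊆-map-image f {p} p⊆Fs = Any.map⁺ (Any.map
  {P = p ⊆_} {Q = λ F → image f p ⊆ image f F} (λ p⊆F → image-mono f p⊆F) p⊆Fs)

-- Injectivity enters twice: images keep their size, and the images of two sets meet only in the
-- image of their intersection.
constructible-image : ∀ {f : Fin n → Fin m} → Injective _≡_ _≡_ f →
  ∀ {Fs} → Constructible d Fs → Constructible d (map (image f) Fs)
constructible-image inj (simplex {F = F} e) = simplex (≡.trans (∣image∣ inj F) e)
constructible-image {f = f} inj (union {d} {Fs} {Gs} cFs cGs cHs Fs∩Gs⊆Hs Hs⊆Fs Hs⊆Gs) =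
  ≡.subst (Constructible (suc d)) (≡.sym (map-++ (image f) Fs Gs))
    (union (constructible-image inj cFs) (constructible-image inj cGs)
      (constructible-image inj cHs)
      (All.map⁺ (All.map (λ {F} F∩Gs⊆Hs → All.map⁺ (All.map (λ {G} F∩G⊆Hs →
        any-⊆-antimono (image-∩-⊆ inj F G) (any-⊆-map-image f F∩G⊆Hs))
        F∩Gs⊆Hs)) Fs∩Gs⊆Hs))
      (All.map⁺ (All.map (any-⊆-map-image f) Hs⊆Fs))
      (All.map⁺ (All.map (any-⊆-map-image f) Hs⊆Gs)))

-- Looks for a shelling whose last facet is the head of the list.
shelling : ∀ d (Fs : List (Subset n)) → Maybe (Constructible d Fs)
shelling d []           = nothing
shelling d (F ∷ [])     = Maybe.map simplex (dec⇒maybe (∣ F ∣ ℕ.≟ d))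
shelling zero (_ ∷ _ ∷ _) = nothing
shelling (suc d) (F ∷ Gs@(_ ∷ _)) =
  -- The head must meet the rest in a pure complex, so only the intersections of size `d` are taken
  -- as generators; the later checks confirm that they suffice. Duplicates must go: a facet meets
  -- its repetition in itself, which is too large for the recursive call.
  case deduplicate _≟ˢ_ (filter (λ H → ∣ H ∣ ℕ.≟ d) (map (F ∩_) Gs)) of λ Hs → do
    ∣F∣≡1+d  ← dec⇒maybe (∣ F ∣ ℕ.≟ suc d)
    cGs      ← shelling (suc d) Gs
    cHs      ← shelling d Hs
    F∩Gs⊆Hs  ← dec⇒maybe (All.all? (λ F → All.all? (λ G → Any.any? (F ∩ G ⊆?_) Hs) Gs) (F ∷ []))
    Hs⊆F     ← dec⇒maybe (All.all? (λ H → Any.any? (H ⊆?_) (F ∷ [])) Hs)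
    Hs⊆Gs    ← dec⇒maybe (All.all? (λ H → Any.any? (H ⊆?_) Gs) Hs)
    just (union (simplex ∣F∣≡1+d) cGs cHs F∩Gs⊆Hs Hs⊆F Hs⊆Gs)

-- Gluing copies

unsplit : ∀ (W : Subset n) → Fin ∣ W ∣ ⊎ Fin ∣ ∁ W ∣ → Fin n
unsplit (true  ∷ W) (inj₁ zero)    = zero
unsplit (true  ∷ W) (inj₁ (suc x)) = suc (unsplit W (inj₁ x))
unsplit (true  ∷ W) (inj₂ y)       = suc (unsplit W (inj₂ y))
unsplit (false ∷ W) (inj₁ x)       = suc (unsplit W (inj₁ x))
unsplit (false ∷ W) (inj₂ zero)    = zero
unsplit (false ∷ W) (inj₂ (suc y)) = suc (unsplit W (inj₂ y))

unsplit-split : ∀ (W : Subset n) v → unsplit W (split W v) ≡ v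
unsplit-split (true  ∷ W) zero    = ≡.refl
unsplit-split (false ∷ W) zero    = ≡.refl
unsplit-split (true  ∷ W) (suc v) with split W v | unsplit-split W v
... | inj₁ _ | e = ≡.cong suc e
... | inj₂ _ | e = ≡.cong suc e
unsplit-split (false ∷ W) (suc v) with split W v | unsplit-split W v
... | inj₁ _ | e = ≡.cong suc e
... | inj₂ _ | e = ≡.cong suc e

split-∈ : ∀ {W : Subset n} {v} → v ∈ W → ∃ λ x → split W v ≡ inj₁ x
split-∈ here = zero , ≡.refl
split-∈ {W = true  ∷ W} (there v∈W) = let x , e = split-∈ v∈W in suc x , ≡.cong (Sum.map₁ suc) e
split-∈ {W = false ∷ W} (there v∈W) = let x , e = split-∈ v∈W in x , ≡.cong (Sum.map₂ suc) e

split-∉ : ∀ {W : Subset n} {v} → v ∉ W → ∃ λ y → split W v ≡ inj₂ y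
split-∉ {W = true  ∷ W} {zero}  v∉W = contradiction here v∉W
split-∉ {W = false ∷ W} {zero}  v∉W = zero , ≡.refl
split-∉ {W = true  ∷ W} {suc v} v∉W =
  let y , e = split-∉ (v∉W ∘ there) in y , ≡.cong (Sum.map₁ suc) e
split-∉ {W = false ∷ W} {suc v} v∉W =
  let y , e = split-∉ (v∉W ∘ there) in suc y , ≡.cong (Sum.map₂ suc) e

module _ (N : ℕ) (W : Subset n) where

  -- The projection that forgets the copy, a common left inverse of all the maps `copy W i`.
  original : Fin (∣ W ∣ ℕ.+ N ℕ.* ∣ ∁ W ∣) → Fin n
  original = unsplit W ∘ Sum.map₂ (proj₂ ∘ remQuot {N} ∣ ∁ W ∣) ∘ splitAt ∣ W ∣

  original-copy : ∀ i v → original (copy W i v) ≡ v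
  original-copy i v
    rewrite Fin.splitAt-join ∣ W ∣ (N ℕ.* ∣ ∁ W ∣) (Sum.map₂ (combine {N} i) (split W v))
    with split W v | unsplit-split W v
  ... | inj₁ _ | e = e
  ... | inj₂ y | e =
    ≡.trans (≡.cong (unsplit W ∘ inj₂ ∘ proj₂) (Fin.remQuot-combine {N} i y)) e

  copy-injective₂ : ∀ {i j v w} → copy {N = N} W i v ≡ copy W j w → v ≡ w
  copy-injective₂ {i} {j} {v} {w} e =
    ≡.trans (≡.sym (original-copy i v)) (≡.trans (≡.cong original e) (original-copy j w))

  copy-injective : ∀ i → Injective _≡_ _≡_ (copy {N = N} W i)
  copy-injective i = copy-injective₂

  copy-∈ : ∀ {v} i j → v ∈ W → copy {N = N} W i v ≡ copy W j v
  copy-∈ {v} i j v∈W = ≡.trans (copy≡ i) (≡.sym (copy≡ j))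
    where
    copy≡ : ∀ k → copy {N = N} W k v ≡ join ∣ W ∣ _ (inj₁ (proj₁ (split-∈ v∈W)))
    copy≡ k = ≡.cong (join ∣ W ∣ _ ∘ Sum.map₂ (combine k)) (proj₂ (split-∈ v∈W))

  -- A vertex outside `W` is numbered by `combine`, from which the index of its copy can be read
  -- off.
  copy-∉ : ∀ {v w i j} → v ∉ W → copy {N = N} W i v ≡ copy W j w → i ≡ j
  copy-∉ {v} {w} {i} {j} v∉W e with copy-injective₂ e
  ... | ≡.refl with split-∉ v∉W
  ... | y , e′ = Fin.combine-injectiveˡ i y j y (inj₂-injective
    (≡.trans (≡.sym (splitAt-copy i)) (≡.trans (≡.cong (splitAt ∣ W ∣) e) (splitAt-copy j))))
    where
    splitAt-copy : ∀ k → splitAt ∣ W ∣ (copy {N = N} W k v) ≡ inj₂ (combine k y)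
    splitAt-copy k = ≡.trans (Fin.splitAt-join ∣ W ∣ _ _) (≡.cong (Sum.map₂ (combine k)) e′)

  ∈-image-copy⁻ : ∀ i {x p} → x ∈ image (copy W i) p →
    original x ∈ p × copy W i (original x) ≡ x
  ∈-image-copy⁻ i {p = p} x∈ with ∈-image⁻ (copy W i) p x∈
  ... | v , v∈p , ≡.refl =
      ≡.subst (_∈ p) (≡.sym (original-copy i v)) v∈p
    , ≡.cong (copy W i) (original-copy i v)

  image-copy-shared : ∀ {p} i j → p ⊆ W → image (copy {N = N} W i) p ⊆ image (copy W j) p
  image-copy-shared {p} i j p⊆W x∈ with ∈-image⁻ (copy W i) p x∈
  ... | v , v∈p , ≡.refl =
    ≡.subst (_∈ _) (copy-∈ j i (p⊆W v∈p)) (∈-image⁺ (copy W j) v∈p)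

  image-copy-∩ : ∀ {i j} → i ≢ j → ∀ p q →
    image (copy {N = N} W i) p ∩ image (copy W j) q ⊆ image (copy W i) (p ∩ W)
  image-copy-∩ {i} {j} i≢j p q x∈ with x∈p∩q⁻ (image (copy W i) p) _ x∈
  ... | x∈ᵢ , x∈ⱼ with ∈-image⁻ (copy W i) p x∈ᵢ | ∈-image⁻ (copy W j) q x∈ⱼ
  ... | v , v∈p , ≡.refl | w , _ , e with v ∈? W
  ... | yes v∈W = ∈-image⁺ (copy W i) (x∈p∩q⁺ (v∈p , v∈W))
  ... | no  v∉W = contradiction (copy-∉ v∉W (≡.sym e)) i≢j

  copies : List (Fin N) → List (Subset n) → List (Subset (∣ W ∣ ℕ.+ N ℕ.* ∣ ∁ W ∣))
  copies is Fs = concatMap (λ i → map (image (copy W i)) Fs) is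

  -- Copies are attached one at a time. By `image-copy-∩`, a copy meets those with other indices
  -- only in its part over `W`, which is generated by `Hs` and is the same in every copy.
  constructible-copies : ∀ {Fs Hs} →
    Constructible (suc d) Fs → Constructible d Hs →
    All (_⊆ W) Hs → All (λ H → Any (H ⊆_) Fs) Hs → All (λ F → Any (F ∩ W ⊆_) Hs) Fs →
    ∀ {i is} → Unique (i ∷ is) → Constructible (suc d) (copies (i ∷ is) Fs)
  constructible-copies {d} {Fs = Fs} cFs cHs Hs⊆W Hs⊆Fs Fs∩W⊆Hs {i} {[]} _ =
    ≡.subst (Constructible (suc d)) (≡.sym (++-identityʳ _))
      (constructible-image (copy-injective i) cFs)
  constructible-copies {Fs = Fs} cFs cHs Hs⊆W Hs⊆Fs Fs∩W⊆Hs {i} {j ∷ is} (i∉js ∷ uniq) =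
    union (constructible-image (copy-injective i) cFs)
      (constructible-copies cFs cHs Hs⊆W Hs⊆Fs Fs∩W⊆Hs uniq)
      (constructible-image (copy-injective i) cHs)
      (All.map⁺ (All.map (λ {F} F∩W⊆Hs →
        All.concat⁺ (All.map⁺ (All.map (λ i≢j → All.map⁺ (All.universal (λ G →
          any-⊆-antimono (image-copy-∩ i≢j F G) (any-⊆-map-image (copy W i) F∩W⊆Hs))
          Fs)) i∉js))) Fs∩W⊆Hs))
      (All.map⁺ (All.map (any-⊆-map-image (copy W i)) Hs⊆Fs))
      -- The shared faces also lie in copy `j`, the first of those remaining.
      (All.map⁺ (All.tabulate λ {H} H∈Hs → Any.++⁺ˡ (any-⊆-antimono
        (image-copy-shared {H} i j (All.lookup Hs⊆W H∈Hs))
        (any-⊆-map-image (copy W j) (All.lookup Hs⊆Fs H∈Hs)))))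

module _ {N : ℕ} (W : Subset n) (Δ : SimplicialComplex n) where

  glue-face⁺ : ∀ {i H G} → Face Δ H → G ⊆ image (copy W i) H → Face (glue N Δ W) G
  glue-face⁺ {i} {H} H∈Δ G⊆H = i , H , H∈Δ , λ x∈G → ∈-image⁻ (copy W i) H (G⊆H x∈G)

  glue-face⁻ : ∀ {G} → Face (glue N Δ W) G →
    ∃₂ λ i H → Face Δ H × G ⊆ image (copy W i) H
  glue-face⁻ (i , H , H∈Δ , G⊆H) = i , H , H∈Δ , λ x∈G →
    let v , v∈H , e = G⊆H x∈G in ≡.subst (_∈ _) e (∈-image⁺ (copy W i) v∈H)

  module _ {Fs} (Δ⊆Fs : ∀ {G} → Face Δ G → Any (G ⊆_) Fs) where

    glue⊆copies : ∀ {G} → Face (glue N Δ W) G → Any (G ⊆_) (copies N W (allFin N) Fs)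
    glue⊆copies G∈ = let i , H , H∈Δ , G⊆H = glue-face⁻ G∈ in
      Any.concatMap⁺ _ (Any.map
        (λ { ≡.refl → any-⊆-antimono G⊆H (any-⊆-map-image (copy W i) (Δ⊆Fs H∈Δ)) })
        (∈-allFin i))

  module _ {Fs} (Fs⊆Δ : All (Face Δ) Fs) where

    copies⊆glue : ∀ {G} → Any (G ⊆_) (copies N W (allFin N) Fs) → Face (glue N Δ W) G
    copies⊆glue G⊆ =
      let i , _ , G⊆ᵢ    = find (Any.concatMap⁻ (λ i → map (image (copy W i)) Fs)
                                    {xs = allFin N} G⊆)
          F , F∈Fs , G⊆F = find (Any.map⁻ G⊆ᵢ)
      in glue-face⁺ {i} (All.lookup Fs⊆Δ F∈Fs) G⊆F

-- Rank and colouring of the glued complex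

glue-hasRank : ∀ {N} {W : Subset n} {Δ} → HasRank Δ d → HasRank (glue (suc N) Δ W) d
glue-hasRank {N = N} {W} {Δ} (≤d , F , F∈Δ , ∣F∣≡d) =
    (λ G∈ → let i , H , H∈Δ , G⊆H = glue-face⁻ {N = suc N} W Δ G∈ in
      ℕ.≤-trans (p⊆q⇒∣p∣≤∣q∣ G⊆H)
        (ℕ.≤-trans (ℕ.≤-reflexive (∣image∣ (copy-injective (suc N) W i) H)) (≤d H∈Δ)))
  , image (copy {N = suc N} W zero) F
  , glue-face⁺ {N = suc N} W Δ {zero} F∈Δ ⊆-refl
  , ≡.trans (∣image∣ (copy-injective (suc N) W zero) F) ∣F∣≡d

-- Each vertex takes the colour of its original. An edge lies within one copy, where `original` is
-- injective.
glue-colorable : ∀ {N} {W : Subset n} {Δ} → Colorable Δ d → Colorable (glue N Δ W) d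
glue-colorable {N = N} {W} {Δ} (κ , proper) = κ ∘ original N W , λ {u} {v} u≢v uv∈ →
  let i , H , H∈Δ , uv⊆H = glue-face⁻ {N = N} W Δ uv∈
      u∈H , eᵤ = ∈-image-copy⁻ N W i (uv⊆H (p⊆p∪q ⁅ v ⁆ (x∈⁅x⁆ u)))
      v∈H , eᵥ = ∈-image-copy⁻ N W i (uv⊆H (q⊆p∪q ⁅ u ⁆ _ (x∈⁅x⁆ v)))
  in proper
    (λ e → u≢v (≡.trans (≡.sym eᵤ) (≡.trans (≡.cong (copy W i) e) eᵥ)))
    (down-closed Δ
      (λ x∈ → [ (λ x∈u → ≡.subst (_∈ H) (≡.sym (x∈⁅y⁆⇒x≡y _ x∈u)) u∈H)
              , (λ x∈v → ≡.subst (_∈ H) (≡.sym (x∈⁅y⁆⇒x≡y _ x∈v)) v∈H) ]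
              (x∈p∪q⁻ ⁅ original N W u ⁆ _ x∈))
      H∈Δ)

-- Restricting a partition to one copy

preimage : (Fin n → Fin m) → Subset m → Subset n
preimage f p = Vec.tabulate (Vec.lookup p ∘ f)

∈-preimage⁺ : ∀ (f : Fin n → Fin m) {v p} → f v ∈ p → v ∈ preimage f p
∈-preimage⁺ f {v} fv∈p =
  lookup⇒[]= v _ (≡.trans (lookup∘tabulate _ v) ([]=⇒lookup fv∈p))

∈-preimage⁻ : ∀ (f : Fin n → Fin m) {v p} → v ∈ preimage f p → f v ∈ p
∈-preimage⁻ f {v} {p} v∈ =
  lookup⇒[]= (f v) p (≡.trans (≡.sym (lookup∘tabulate _ v)) ([]=⇒lookup v∈))

⊈⇒∃∉ : ∀ {p q : Subset n} → p ⊈ q → ∃ λ v → v ∈ p × v ∉ q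
⊈⇒∃∉ {p = p} {q} p⊈q with Fin.any? (λ v → (v ∈? p) ×-dec ¬? (v ∈? q))
... | yes v∈p∖q = v∈p∖q
... | no  ∄     = contradiction (λ {x} → p⊆q {x}) p⊈q
  where
  p⊆q : p ⊆ q
  p⊆q {x} x∈p with x ∈? q
  ... | yes x∈q = x∈q
  ... | no  x∉q = contradiction (x , x∈p , x∉q) ∄

-- A right inverse of `f` would be an injection from `Fin n` to `Fin m`, against the pigeonhole
-- principle.
<⇒nonsurjective : m < n → (f : Fin m → Fin n) → ∃ λ i → ∀ k → f k ≢ i
<⇒nonsurjective {n = n} m<n f =
  let i , i∉f = Fin.¬∀⟶∃¬ n _ (λ i → Fin.any? λ k → f k Fin.≟ i) no-section
  in i , λ k e → i∉f (k , e)
  where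
  no-section : ¬ (∀ i → ∃ λ k → f k ≡ i)
  no-section g =
    let i , j , i<j , gi≡gj = Fin.pigeonhole m<n (proj₁ ∘ g)
    in Fin.<⇒≢ i<j (≡.trans (≡.sym (proj₂ (g i))) (≡.trans (≡.cong f gi≡gj) (proj₂ (g j))))

-- Partitions of the faces of Δ outside the subcomplex induced on W.
RelativelyPartitionable : SimplicialComplex n → Subset n → Set
RelativelyPartitionable {n} Δ W = ∃ λ (r : Subset n → Subset n) →
  (∀ {F} → IsFacet Δ F → r F ⊈ W) ×
  (∀ {G} → Face Δ G → G ⊈ W → ∃! _≡_ λ F → IsFacet Δ F × r F ⊆ G × G ⊆ F)

module _ {N : ℕ} (W : Subset n) (Δ : SimplicialComplex n)
         (facet-⊈ : ∀ {F} → IsFacet Δ F → F ⊈ W) where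

  private
    K = glue N Δ W
    _at_ : Subset n → Fin N → Subset _
    G at i = image (copy W i) G

  facet⁻ : ∀ {F′} → IsFacet K F′ → ∃₂ λ i F → IsFacet Δ F × F′ ≡ F at i
  facet⁻ (F′∈K , maximal) with glue-face⁻ W Δ F′∈K
  ... | i , H , H∈Δ , F′⊆H =
      i , H
    , (H∈Δ , λ G∈Δ H⊆G → image-injective (copy-injective N W i)
        (≡.trans (≡.sym F′≡H)
          (maximal (glue-face⁺ W Δ G∈Δ ⊆-refl)
                   (⊆-trans F′⊆H (image-mono (copy W i) H⊆G)))))
    , F′≡H
    where
    F′≡H = maximal (glue-face⁺ W Δ H∈Δ ⊆-refl) F′⊆H

  same-copy : ∀ {i j G H} → G ⊈ W → G at i ⊆ H at j → i ≡ j
  same-copy {i} {j} {H = H} G⊈W G⊆H with ⊈⇒∃∉ G⊈W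
  ... | v , v∈G , v∉W with ∈-image⁻ (copy W j) H (G⊆H (∈-image⁺ (copy W i) v∈G))
  ... | w , _ , e = copy-∉ N W v∉W (≡.sym e)

  -- A face containing `F at i` lies in some `H at j`. As `F` has a vertex outside `W`, the copies
  -- `i` and `j` agree, and maximality in `Δ` applies.
  facet⁺ : ∀ i {F} → IsFacet Δ F → IsFacet K (F at i)
  facet⁺ i {F} F-facet@(F∈Δ , maximal) = glue-face⁺ W Δ F∈Δ ⊆-refl , λ {G} G∈K F⊆G →
    let j , H , H∈Δ , G⊆H = glue-face⁻ W Δ G∈K
        F⊆H : F at i ⊆ H at j
        F⊆H = λ x∈F → G⊆H (F⊆G x∈F)
    in ⊆-antisym F⊆G (back (same-copy {i} {j} {F} {H} (facet-⊈ F-facet) F⊆H) H∈Δ F⊆H G⊆H)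
    where
    back : ∀ {j H G} → i ≡ j → Face Δ H → F at i ⊆ H at j → G ⊆ H at j → G ⊆ F at i
    back {H = H} {G} ≡.refl H∈Δ F⊆H G⊆H =
      ≡.subst (λ F → G ⊆ F at i)
        (≡.sym (maximal H∈Δ (image-reflects-⊆ (copy-injective N W i) F⊆H))) G⊆H

  -- The intervals of the facets in copy `i` are pulled back along `copy W i`; by hypothesis none of
  -- them contains a face inside `W`.
  relativelyPartitionable : ∀ i → ((R , _) : Partitionable K) →
    (∀ {F G} → IsFacet Δ F → G ⊆ F → R (F at i) ⊆ G at i → G ⊈ W) →
    RelativelyPartitionable Δ W
  relativelyPartitionable i (R , R⊆ , part) R⊈W = r , r⊈W , r-part
    where
    inj = copy-injective N W i

    r : Subset n → Subset n
    r F = preimage (copy W i) (R (F at i))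

    r⊆ : ∀ {F} → IsFacet Δ F → r F ⊆ F
    r⊆ {F} F-facet v∈r with ∈-image⁻ (copy W i) F
      (R⊆ (facet⁺ i F-facet) (∈-preimage⁻ (copy W i) v∈r))
    ... | w , w∈F , e = ≡.subst (_∈ F) (inj e) w∈F

    R⊆at : ∀ {F G} → IsFacet Δ F → r F ⊆ G → R (F at i) ⊆ G at i
    R⊆at {F} F-facet r⊆G x∈R with ∈-image⁻ (copy W i) F (R⊆ (facet⁺ i F-facet) x∈R)
    ... | v , _ , ≡.refl = ∈-image⁺ (copy W i) (r⊆G (∈-preimage⁺ (copy W i) x∈R))

    -- The bottom of an interval belongs to it, so the hypothesis applies to `r F` itself.
    r⊈W : ∀ {F} → IsFacet Δ F → r F ⊈ W
    r⊈W F-facet = R⊈W F-facet (r⊆ F-facet) (R⊆at F-facet ⊆-refl)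

    r-part : ∀ {G} → Face Δ G → G ⊈ W → ∃! _≡_ λ F → IsFacet Δ F × r F ⊆ G × G ⊆ F
    r-part {G} G∈Δ G⊈W with part (glue-face⁺ W Δ {i} G∈Δ ⊆-refl)
    ... | F′ , (F′-facet , R⊆G , G⊆F′) , unique with facet⁻ F′-facet
    -- A facet containing a face that is not inside `W` belongs to the same copy as that face.
    ... | j , F , F-facet , ≡.refl with same-copy {i} {j} {G} {F} G⊈W G⊆F′
    ... | ≡.refl =
        F
      , ( F-facet
        , (λ v∈r → let w , w∈G , e = ∈-image⁻ (copy W i) G (R⊆G (∈-preimage⁻ (copy W i) v∈r))
                   in ≡.subst (_∈ G) (inj e) w∈G)
        , image-reflects-⊆ inj G⊆F′)
      , λ (F₁-facet , r⊆G , G⊆F₁) → image-injective inj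
          (unique (facet⁺ i F₁-facet , R⊆at F₁-facet r⊆G , image-mono (copy W i) G⊆F₁))

-- Each face of the induced subcomplex lies in an interval of one copy only, so
-- when there are more copies than such faces, some copy has none of them.
glue-relativelyPartitionable : ∀ {N} (W : Subset n) (Δ : SimplicialComplex n)
  (As : List (Subset n)) → All (Face Δ) As →
  (∀ {G} → Face Δ G → G ⊆ W → G ∈ₗ As) → length As < suc N →
  (∀ {F} → IsFacet Δ F → F ⊈ W) →
  Partitionable (glue (suc N) Δ W) → RelativelyPartitionable Δ W
glue-relativelyPartitionable {n} {N} W Δ As As⊆Δ Δ∣W⊆As ∣As∣<1+N facet-⊈ 𝓡@(R , R⊆ , part) =
  let i , homeless = <⇒nonsurjective ∣As∣<1+N
        (λ k → home (All.lookup As⊆Δ (∈-lookup {xs = As} k)))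
  in relativelyPartitionable W Δ facet-⊈ i 𝓡 λ F-facet G⊆F R⊆G G⊆W →
    let G∈As = Δ∣W⊆As (down-closed Δ G⊆F (proj₁ F-facet)) G⊆W
        k    = Any.index G∈As
        Aₖ∈Δ = All.lookup As⊆Δ (∈-lookup {xs = As} k)
    in homeless k (home≡ Aₖ∈Δ G⊆W F-facet G⊆F R⊆G (Any.lookup-index G∈As))
  where
  K = glue (suc N) Δ W

  _at_ : Subset n → Fin (suc N) → Subset _
  G at i = image (copy W i) G

  at-zero : ∀ {G} → Face Δ G → Face K (G at zero)
  at-zero G∈Δ = glue-face⁺ W Δ {zero} G∈Δ ⊆-refl

  -- The copy whose facet owns `G`. It is computed from copy `zero`, which is harmless for `G ⊆ W`,
  -- as the images of `G` in all copies coincide.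
  home : ∀ {G} → Face Δ G → Fin (suc N)
  home {G} G∈Δ =
    let _ , (F-facet , _) , _ = part (at-zero G∈Δ) in proj₁ (facet⁻ W Δ facet-⊈ F-facet)

  home≡ : ∀ {G A i F} (A∈Δ : Face Δ A) → G ⊆ W → IsFacet Δ F → G ⊆ F →
    R (F at i) ⊆ G at i → G ≡ A → home A∈Δ ≡ i
  home≡ {G} {i = i} {F} G∈Δ G⊆W F-facet G⊆F R⊆G ≡.refl with part (at-zero G∈Δ)
  ... | F′ , (F′-facet , _) , unique =
    let j , F₁ , F₁-facet , F′≡F₁ = facet⁻ W Δ facet-⊈ F′-facet
    in same-copy W Δ facet-⊈ {j} {i} {F₁} {F} (facet-⊈ F₁-facet)
      (⊆-reflexive (≡.trans (≡.sym F′≡F₁)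
        (unique ( facet⁺ W Δ facet-⊈ i F-facet
                , (λ x∈R → image-copy-shared (suc N) W i zero G⊆W (R⊆G x∈R))
                , (λ x∈G → image-mono (copy W i) G⊆F
                    (image-copy-shared (suc N) W zero i G⊆W x∈G))))))

-- The glued complex has the same faces as the constructible complex generated by all copies of
-- `Fs`, and vanishing of homology depends only on the faces.
glue-cohenMacaulay : ∀ {c ℓ₁ ℓ₂} (𝔽 : HeytingField c ℓ₁ ℓ₂) →
  ∀ N (W : Subset n) (Δ : SimplicialComplex n) {Fs Hs} → HasRank Δ (suc d) →
  (∀ {G} → Face Δ G → Any (G ⊆_) Fs) → All (Face Δ) Fs →
  Constructible (suc d) Fs → Constructible d Hs →
  All (_⊆ W) Hs → All (λ H → Any (H ⊆_) Fs) Hs → All (λ F → Any (F ∩ W ⊆_) Hs) Fs →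
  CohenMacaulay 𝔽 (glue (suc N) Δ W)
glue-cohenMacaulay {d = d} 𝔽 N W Δ {Fs} rank Δ⊆Fs Fs⊆Δ cFs cHs Hs⊆W Hs⊆Fs Fs∩W⊆Hs =
    suc d
  , glue-hasRank {W = W} {Δ} rank
  , λ {F} _ i i≢ → vanishes-respects-⇔ R
      {Δ = link (generatedBy (copies (suc N) W (allFin (suc N)) Fs)) F}
      (λ (e , G∈) → e , copies⊆glue W Δ Fs⊆Δ G∈)
      (λ (e , G∈) → e , glue⊆copies W Δ Δ⊆Fs G∈)
      (link-vanishes R
        (constructible-copies (suc N) W cFs cHs Hs⊆W Hs⊆Fs Fs∩W⊆Hs (allFin⁺ (suc N))) F i i≢)
  where
  R = HeytingCommutativeRing.commutativeRing (HeytingField.heytingCommutativeRing 𝔽)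

-- Refuting relative partitions by a finite search

module _ (W : Subset n) (Fs : List (Subset n)) where

  -- An entry (F , U) records that r F ⊆ U.
  State : Set
  State = List (Subset n × Subset n)

  -- If the interval of `F` contains `G`, then `r F` lies in `G` as well as in every set recorded
  -- for `F`; this is the resulting bound.
  meet : State → Subset n → Subset n → Subset n
  meet st F G = foldr (λ (F′ , U) V → if does (F ≟ˢ F′) then U ∩ V else V) G st

  -- Given `r F ⊆ V`, both alternatives are absurd: `r F` would lie in `W`, or the intervals of two
  -- distinct facets `F` and `F′` would share the face `V ∪ U`.
  Clash : State → Subset n → Subset n → Set
  Clash st F V = V ⊆ W ⊎ Any (λ (F′ , U) → F ≢ F′ × V ∪ U ⊆ F ∩ F′) st

  clash? : ∀ st F V → Dec (Clash st F V)
  clash? st F V = (V ⊆? W) ⊎-dec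
    Any.any? (λ (F′ , U) → ¬? (F ≟ˢ F′) ×-dec (V ∪ U ⊆? F ∩ F′)) st

  -- The search over the facets whose interval contains the listed faces in
  -- turn fails.
  Refuted : List (Subset n) → State → Set
  Refuted []       st = False
  Refuted (G ∷ Gs) st = All (λ F → G ⊈ F ⊎
    Clash st F (meet st F G) ⊎ Refuted Gs ((F , meet st F G) ∷ st)) Fs

  refuted? : ∀ Gs st → Dec (Refuted Gs st)
  refuted? []       st = no λ ()
  refuted? (G ∷ Gs) st = All.all? (λ F → ¬? (G ⊆? F) ⊎-dec
    clash? st F (meet st F G) ⊎-dec refuted? Gs ((F , meet st F G) ∷ st)) Fs

  -- A partition selects one branch at each level, that of the facet owning the listed face. The
  -- bounds stay valid along this branch, so it meets no clash, while the refutation offers it no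
  -- other end.
  refuted⇒¬relativelyPartitionable : ∀ {Δ : SimplicialComplex n} {Gs} →
    (∀ {F} → IsFacet Δ F → F ∈ₗ Fs) → All (Face Δ) Gs → All (_⊈ W) Gs →
    Refuted Gs [] → ¬ RelativelyPartitionable Δ W
  refuted⇒¬relativelyPartitionable {Δ} facet⇒∈ Gs⊆Δ Gs⊈W refuted (r , r⊈W , part) =
    go Gs⊆Δ Gs⊈W [] refuted
    where
    Valid : Subset n × Subset n → Set
    Valid (F , U) = IsFacet Δ F × r F ⊆ U

    r⊆meet : ∀ {st F G} → All Valid st → r F ⊆ G → r F ⊆ meet st F G
    r⊆meet [] r⊆G = r⊆G
    r⊆meet {(F′ , _) ∷ _} {F} ((_ , r⊆U) ∷ valid) r⊆G with F ≟ˢ F′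
    ... | yes ≡.refl = λ x∈r → x∈p∩q⁺ (r⊆U x∈r , r⊆meet valid r⊆G x∈r)
    ... | no  _      = r⊆meet valid r⊆G

    ¬clash : ∀ {st F V} → All Valid st → IsFacet Δ F → r F ⊆ V → ¬ Clash st F V
    ¬clash valid F-facet r⊆V (inj₁ V⊆W) = r⊈W F-facet λ x∈r → V⊆W (r⊆V x∈r)
    ¬clash {F = F} {V} ((F′-facet , r⊆U) ∷ _) F-facet r⊆V
      (inj₂ (here {F′ , U} (F≢F′ , V∪U⊆F∩F′))) =
      let _ , _ , unique = part
            (down-closed Δ (λ x∈ → proj₁ (x∈p∩q⁻ F F′ (V∪U⊆F∩F′ x∈))) (proj₁ F-facet))
            (λ V∪U⊆W → r⊈W F-facet λ x∈r → V∪U⊆W (p⊆p∪q U (r⊆V x∈r)))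
      in F≢F′ (≡.trans
        (≡.sym (unique (F-facet , (λ x∈r → p⊆p∪q U (r⊆V x∈r))
                                , λ x∈ → proj₁ (x∈p∩q⁻ F F′ (V∪U⊆F∩F′ x∈)))))
        (unique (F′-facet , (λ x∈r → q⊆p∪q V U (r⊆U x∈r))
                          , λ x∈ → proj₂ (x∈p∩q⁻ F F′ (V∪U⊆F∩F′ x∈)))))
    ¬clash (_ ∷ valid) F-facet r⊆V (inj₂ (there c)) = ¬clash valid F-facet r⊆V (inj₂ c)

    go : ∀ {Gs st} → All (Face Δ) Gs → All (_⊈ W) Gs → All Valid st → ¬ Refuted Gs st
    go [] [] valid ()
    go (G∈Δ ∷ Gs⊆Δ) (G⊈W ∷ Gs⊈W) valid refuted with part G∈Δ G⊈W
    ... | F , (F-facet , r⊆G , G⊆F) , _ with All.lookup refuted (facet⇒∈ F-facet)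
    ... | inj₁ G⊈F               = G⊈F G⊆F
    ... | inj₂ (inj₁ clash)      = ¬clash valid F-facet (r⊆meet valid r⊆G) clash
    ... | inj₂ (inj₂ refuted′)   =
      go Gs⊆Δ Gs⊈W ((F-facet , r⊆meet valid r⊆G) ∷ valid) refuted′

-- The complexes Q* and A*

subsets : Subset n → List (Subset n)
subsets []          = [] ∷ []
subsets (true  ∷ p) = map (true ∷_) (subsets p) ++ map (false ∷_) (subsets p)
subsets (false ∷ p) = map (false ∷_) (subsets p)

∈-subsets⁺ : ∀ {p q : Subset n} → p ⊆ q → p ∈ₗ subsets q
∈-subsets⁺ {p = []}        {[]}        _   = here ≡.refl
∈-subsets⁺ {p = true  ∷ p} {true  ∷ q} p⊆q =
  ∈-++⁺ˡ (∈-map⁺ (true ∷_) (∈-subsets⁺ (drop-∷-⊆ p⊆q)))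
∈-subsets⁺ {p = false ∷ p} {true  ∷ q} p⊆q =
  ∈-++⁺ʳ (map (true ∷_) (subsets q)) (∈-map⁺ (false ∷_) (∈-subsets⁺ (drop-∷-⊆ p⊆q)))
∈-subsets⁺ {p = true  ∷ p} {false ∷ q} p⊆q = case p⊆q here of λ ()
∈-subsets⁺ {p = false ∷ p} {false ∷ q} p⊆q = ∈-map⁺ (false ∷_) (∈-subsets⁺ (drop-∷-⊆ p⊆q))

-- The facets of `Q*` in an order whose reverse is a shelling, since `shelling` splits off the head
-- as the last facet.
Q*-facets : List (Subset 14)
Q*-facets = map fromElements (
  (# 4 ∷ # 5 ∷ # 7 ∷ # 13 ∷ []) ∷
  (# 1 ∷ # 4 ∷ # 5 ∷ # 7 ∷ []) ∷
  (# 4 ∷ # 5 ∷ # 8 ∷ # 13 ∷ []) ∷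
  (# 1 ∷ # 4 ∷ # 5 ∷ # 8 ∷ []) ∷
  (# 1 ∷ # 5 ∷ # 8 ∷ # 11 ∷ []) ∷
  (# 1 ∷ # 8 ∷ # 9 ∷ # 11 ∷ []) ∷
  (# 1 ∷ # 6 ∷ # 9 ∷ # 11 ∷ []) ∷
  (# 1 ∷ # 5 ∷ # 6 ∷ # 11 ∷ []) ∷
  (# 1 ∷ # 3 ∷ # 4 ∷ # 7 ∷ []) ∷
  (# 1 ∷ # 3 ∷ # 4 ∷ # 10 ∷ []) ∷
  (# 1 ∷ # 2 ∷ # 6 ∷ # 9 ∷ []) ∷
  (# 0 ∷ # 2 ∷ # 5 ∷ # 12 ∷ []) ∷
  (# 1 ∷ # 4 ∷ # 8 ∷ # 9 ∷ []) ∷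
  (# 1 ∷ # 4 ∷ # 9 ∷ # 10 ∷ []) ∷
  (# 1 ∷ # 2 ∷ # 9 ∷ # 10 ∷ []) ∷
  (# 1 ∷ # 2 ∷ # 3 ∷ # 10 ∷ []) ∷
  (# 0 ∷ # 1 ∷ # 2 ∷ # 3 ∷ []) ∷
  (# 0 ∷ # 1 ∷ # 2 ∷ # 5 ∷ []) ∷
  (# 1 ∷ # 2 ∷ # 5 ∷ # 6 ∷ []) ∷
  (# 2 ∷ # 5 ∷ # 6 ∷ # 12 ∷ []) ∷
  [])

-- A strip of triangles in which consecutive ones share an edge.
A*-facets : List (Subset 14)
A*-facets = map fromElements (
  (# 4 ∷ # 8 ∷ # 13 ∷ []) ∷
  (# 4 ∷ # 7 ∷ # 13 ∷ []) ∷
  (# 3 ∷ # 4 ∷ # 7 ∷ []) ∷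
  (# 3 ∷ # 4 ∷ # 10 ∷ []) ∷
  (# 2 ∷ # 3 ∷ # 10 ∷ []) ∷
  (# 0 ∷ # 2 ∷ # 3 ∷ []) ∷
  (# 0 ∷ # 2 ∷ # 12 ∷ []) ∷
  (# 2 ∷ # 6 ∷ # 12 ∷ []) ∷
  [])

Q*-constructible : Constructible 4 Q*-facets
Q*-constructible = from-just (shelling 4 Q*-facets)

A*-constructible : Constructible 3 A*-facets
A*-constructible = from-just (shelling 3 A*-facets)

Q*⊆Q*-facets : ∀ {G} → Face Q* G → Any (G ⊆_) Q*-facets
Q*⊆Q*-facets = any-⊆-trans
  (toWitness {a? = All.all? (λ F → Any.any? (F ⊆?_) Q*-facets) _} _)

Q*-facets⊆Q* : All (Face Q*) Q*-facets
Q*-facets⊆Q* = from-yes (All.all? (face? Q*) Q*-facets)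

A*-facets⊆A* : All (_⊆ A*-vertices) A*-facets
A*-facets⊆A* = from-yes (All.all? (_⊆? A*-vertices) A*-facets)

A*-facets⊆Q*-facets : All (λ H → Any (H ⊆_) Q*-facets) A*-facets
A*-facets⊆Q*-facets = from-yes (All.all? (λ H → Any.any? (H ⊆?_) Q*-facets) A*-facets)

Q*-facets∩A*⊆A*-facets : All (λ F → Any (F ∩ A*-vertices ⊆_) A*-facets) Q*-facets
Q*-facets∩A*⊆A*-facets =
  from-yes (All.all? (λ F → Any.any? (F ∩ A*-vertices ⊆?_) A*-facets) Q*-facets)

Q*-hasRank : HasRank Q* 4
Q*-hasRank =
    (λ G∈ → let F , F∈ , G⊆F = find (Q*⊆Q*-facets G∈) in
      ℕ.≤-trans (p⊆q⇒∣p∣≤∣q∣ G⊆F) (ℕ.≤-reflexive (All.lookup sizes F∈)))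
  , fromElements (# 4 ∷ # 5 ∷ # 7 ∷ # 13 ∷ [])
  , All.head Q*-facets⊆Q*
  , ≡.refl
  where
  sizes : All (λ F → ∣ F ∣ ≡ 4) Q*-facets
  sizes = from-yes (All.all? (λ F → ∣ F ∣ ℕ.≟ 4) Q*-facets)

Q*-colorable : Colorable Q* 4
Q*-colorable = κ , λ {u} {v} → proper u v
  where
  -- The colours of 0, 1, 2, 3 force the others across shared triangles: 5 by 0125, 6 by 1256, 9 by
  -- 1269, 10 by {1,2,9,10}, 4 by {1,4,9,10}, and so on.
  κ : Fin 14 → Fin 4
  κ = Vec.lookup (# 0 ∷ # 1 ∷ # 2 ∷ # 3 ∷ # 2 ∷ # 3 ∷ # 0 ∷
                  # 0 ∷ # 0 ∷ # 3 ∷ # 0 ∷ # 2 ∷ # 1 ∷ # 1 ∷ [])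
  proper : ∀ u v → u ≢ v → Face Q* (⁅ u ⁆ ∪ ⁅ v ⁆) → κ u ≢ κ v
  proper = from-yes (Fin.all? λ u → Fin.all? λ v →
    ¬? (u Fin.≟ v) →-dec face? Q* (⁅ u ⁆ ∪ ⁅ v ⁆) →-dec ¬? (κ u Fin.≟ κ v))

facet⇒∈Q*-facets : ∀ {F} → IsFacet Q* F → F ∈ₗ Q*-facets
facet⇒∈Q*-facets (F∈Q* , maximal) =
  let H , H∈ , F⊆H = find (Q*⊆Q*-facets F∈Q*)
  in ≡.subst (_∈ₗ Q*-facets) (≡.sym (maximal (All.lookup Q*-facets⊆Q* H∈) F⊆H)) H∈

facet⊈A* : ∀ {F} → IsFacet Q* F → F ⊈ A*-vertices
facet⊈A* F-facet = All.lookup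
  (from-yes (All.all? (λ F → ¬? (F ⊆? A*-vertices)) Q*-facets)) (facet⇒∈Q*-facets F-facet)

-- Duplicates are removed because the length of this list is compared with the number of copies.
A*-faces : List (Subset 14)
A*-faces = deduplicate _≟ˢ_ (concatMap subsets A*-facets)

∈-A*-faces : ∀ {G} → Face Q* G → G ⊆ A*-vertices → G ∈ₗ A*-faces
∈-A*-faces {G} G∈Q* G⊆A* =
  let F , F∈ , G⊆F = find (Q*⊆Q*-facets G∈Q*)
      G⊆Hs = any-⊆-antimono {p = G} (λ x∈G → x∈p∩q⁺ (G⊆F x∈G , G⊆A* x∈G))
               (All.lookup Q*-facets∩A*⊆A*-facets F∈)
  in ∈-deduplicate⁺ _≟ˢ_ (∈-concatMap⁺ subsets (Any.map
       {P = G ⊆_} {Q = λ H → G ∈ₗ subsets H} ∈-subsets⁺ G⊆Hs))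

Q*-not-relativelyPartitionable : ¬ RelativelyPartitionable Q* A*-vertices
Q*-not-relativelyPartitionable =
  refuted⇒¬relativelyPartitionable A*-vertices Q*-facets {Δ = Q*} {faces} facet⇒∈Q*-facets
    (from-yes (All.all? (face? Q*) faces))
    (from-yes (All.all? (λ G → ¬? (G ⊆? A*-vertices)) faces))
    (from-yes (refuted? A*-vertices Q*-facets faces []))
  where
  -- The first six faces have one viable owner each, {0,5} and {5,7} have two each, and the
  -- surviving owners of {2,5} and {4,5} clash on {5}.
  faces : List (Subset 14)
  faces = map fromElements (
    (# 2 ∷ # 6 ∷ # 9 ∷ []) ∷ (# 1 ∷ # 2 ∷ # 6 ∷ []) ∷
    (# 4 ∷ # 8 ∷ # 9 ∷ []) ∷ (# 1 ∷ # 4 ∷ # 8 ∷ []) ∷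
    (# 5 ∷ # 6 ∷ # 12 ∷ []) ∷ (# 5 ∷ # 8 ∷ # 13 ∷ []) ∷
    (# 0 ∷ # 5 ∷ []) ∷ (# 5 ∷ # 7 ∷ []) ∷ (# 2 ∷ # 5 ∷ []) ∷ (# 4 ∷ # 5 ∷ []) ∷
    [])

-- The three properties of `C₃₇`

C₃₇-balanced : Balanced C₃₇
C₃₇-balanced = 4
  , glue-hasRank {N = 36} {A*-vertices} {Q*} Q*-hasRank
  , glue-colorable {N = 37} {A*-vertices} {Q*} Q*-colorable

-- Transporting along this equality keeps conversion checking from unfolding
-- CohenMacaulay at two presentations of the same complex.
C₃₇≡glue : _≡_ {A = ∃ SimplicialComplex} (_ , glue (suc 36) Q* A*-vertices) (_ , C₃₇)
C₃₇≡glue = ≡.refl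

C₃₇-cohenMacaulay : ∀ {c ℓ₁ ℓ₂} (𝔽 : HeytingField c ℓ₁ ℓ₂) → CohenMacaulay 𝔽 C₃₇
C₃₇-cohenMacaulay 𝔽 = ≡.subst (λ (_ , K) → CohenMacaulay 𝔽 K) C₃₇≡glue
  (glue-cohenMacaulay 𝔽 36 A*-vertices Q* Q*-hasRank Q*⊆Q*-facets Q*-facets⊆Q*
    Q*-constructible A*-constructible
    A*-facets⊆A* A*-facets⊆Q*-facets Q*-facets∩A*⊆A*-facets)

C₃₇-not-partitionable : ¬ Partitionable C₃₇
C₃₇-not-partitionable 𝓡 = Q*-not-relativelyPartitionable
  (glue-relativelyPartitionable {N = 36} A*-vertices Q* A*-faces
    (from-yes (All.all? (face? Q*) A*-faces)) ∈-A*-faces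
    -- Counted by size from the empty face on, `A*` has 1 + 10 + 17 + 8 = 36 faces, one fewer than
    -- there are copies.
    (from-yes (length A*-faces ℕ.<? 37)) facet⊈A* 𝓡)

theorem3p7 : ∀ {c ℓ₁ ℓ₂} →
    Balanced C₃₇ ×
    ((𝔽 : HeytingField c ℓ₁ ℓ₂) → CohenMacaulay 𝔽 C₃₇) ×
    ¬ Partitionable C₃₇
theorem3p7 = C₃₇-balanced , C₃₇-cohenMacaulay , C₃₇-not-partitionable
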